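{- Let $B \in \mathbb{F}_2[x]$ be an even polynomial such that $\gcd(B^2,\sigma(B^2))=1$. Let $r$ be an integer with $1 \le r \le 3$, let $P_1,\dots,P_r \in \mathbb{F}_2[x]$ be pairwise distinct odd irreducible polynomials with $P_j \nmid B$ for every $j$, and put $A := B^2 P_1 \cdots P_r$. If $A$ is perfect, then $$A \in \{M_{5a},M_{5b},M_{16},M_{20a},M_{20b}\},$$ where $M_{5a} := x(x+1)^2 (x^2+x+1)$, $M_{5b} := M_{5a}\,(x+1)$, $M_{16} := x^4 (x+1)^4 (x^4+x^3+1)(x^4+x^3+x^2+x+1)$, $M_{20a} := x^4 (x+1)^6 (x^3+x+1)(x^3+x^2+1)(x^4+x^3+x^2+x+1)$, and $M_{20b} := M_{20a}\,(x+1)$.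
   Context: $\mathbb{F}_2=\{0,1\}$ is the field with two elements. A polynomial in $\mathbb{F}_2[x]$ is called prime if it is irreducible. A polynomial $B\in\mathbb{F}_2[x]$ is called odd if $B(0)=B(1)=1$, and even otherwise. For $A \in \mathbb{F}_2[x]$, $\sigma(A)=\sum_{D \mid A} D \in \mathbb{F}_2[x]$ denotes the sum of all divisors of $A$ in $\mathbb{F}_2[x]$ (including $1$ and $A$). A polynomial $A\in\mathbb{F}_2[x]$ is called perfect if $\sigma(A)=A$.
   Formalization: M_{5b} and M_{20b} are taken as M_{5a} and M_{20a} with x replaced by x+1, not multiplied by x+1; read as products the claim fails for A = x^6(x+1)^4(x^3+x+1)(x^3+x^2+1)(x^4+x^3+1). -}

module Defs where

open import Data.Bool using (Bool; true; false; _xor_; _∧_; if_then_else_)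
open import Data.List using (List; []; _∷_; length; foldr; map; concatMap; _++_)
open import Data.Nat using (ℕ; zero; suc)
open import Data.Fin using (Fin)
open import Data.Product using (∃)
open import Data.Empty using (⊥)
open import Relation.Nullary using (¬_)
open import Relation.Binary.PropositionalEquality using (_≡_)

-- Polynomials in 𝔽₂[x], represented as little-endian coefficient lists
-- (head = constant coefficient). Trailing zero coefficients are allowed in
-- the raw representation; equality of polynomials is equality of the
-- normal forms (trailing zeros stripped), see _≈_.
Poly : Set
Poly = List Bool

consN : Bool → Poly → Poly
consN false [] = []
consN b xs = b ∷ xs

norm : Poly → Poly
norm [] = []
norm (b ∷ bs) = consN b (norm bs)

_≈_ : Poly → Poly → Set
p ≈ q = norm p ≡ norm q

infix 4 _≈_ _∣_

addRaw : Poly → Poly → Poly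
addRaw [] q = q
addRaw p [] = p
addRaw (a ∷ p) (b ∷ q) = (a xor b) ∷ addRaw p q

infixl 6 _+ₚ_
infixl 7 _*ₚ_

_+ₚ_ : Poly → Poly → Poly
p +ₚ q = norm (addRaw p q)

mulRaw : Poly → Poly → Poly
mulRaw [] q = []
mulRaw (false ∷ p) q = false ∷ mulRaw p q
mulRaw (true ∷ p) q = addRaw q (false ∷ mulRaw p q)

_*ₚ_ : Poly → Poly → Poly
p *ₚ q = norm (mulRaw p q)

zeroP oneP X : Poly
zeroP = []
oneP = true ∷ []
X = false ∷ true ∷ []

_^ₚ_ : Poly → ℕ → Poly
p ^ₚ zero = oneP
p ^ₚ suc n = p *ₚ (p ^ₚ n)

prodFin : (r : ℕ) → (Fin r → Poly) → Poly
prodFin zero P = oneP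
prodFin (suc r) P = P Fin.zero *ₚ prodFin r (λ i → P (Fin.suc i))

eval0 : Poly → Bool
eval0 [] = false
eval0 (b ∷ _) = b

eval1 : Poly → Bool
eval1 = foldr _xor_ false

_∣_ : Poly → Poly → Set
d ∣ a = ∃ λ q → q *ₚ d ≈ a

-- irreducible ("prime"): non-constant, and its only divisors are the
-- units (over 𝔽₂ only 1) and its associates (over 𝔽₂ only itself)
Irreducible : Poly → Set
Irreducible p = ¬ (p ≈ zeroP) × ¬ (p ≈ oneP) × (∀ d → d ∣ p → d ≈ oneP ⊎ d ≈ p)
  where open import Data.Product using (_×_)
        open import Data.Sum using (_⊎_)

Odd : Poly → Set
Odd b = (eval0 b ≡ true) × (eval1 b ≡ true)
  where open import Data.Product using (_×_)

Even : Poly → Set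
Even b = ¬ Odd b

-- gcd(a, b) = 1 : every common divisor is 1 (the only unit of 𝔽₂[x])
GcdOne : Poly → Poly → Set
GcdOne a b = ∀ d → d ∣ a → d ∣ b → d ≈ oneP

eqBool : Bool → Bool → Bool
eqBool true true = true
eqBool false false = true
eqBool _ _ = false

eqList : Poly → Poly → Bool
eqList [] [] = true
eqList (a ∷ p) (b ∷ q) = eqBool a b ∧ eqList p q
eqList _ _ = false

-- all coefficient lists of length n, i.e. every polynomial of degree < n
-- exactly once
allLists : ℕ → List Poly
allLists zero = [] ∷ []
allLists (suc n) = concatMap (λ l → (false ∷ l) ∷ (true ∷ l) ∷ []) (allLists n)

sumP : List Poly → Poly
sumP = foldr _+ₚ_ zeroP

-- σ(A) = Σ_{D ∣ A} D.  For A ≠ 0 of degree d, every divisor D has degree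
-- ≤ d and a unique cofactor Q (also of degree ≤ d) with D·Q = A, so
-- σ(A) is the sum of D over all pairs (D, Q) of polynomials of degree
-- < length(norm A) with D·Q = A.
σ : Poly → Poly
σ a = sumP (concatMap (λ d → concatMap (λ q → if eqList (d *ₚ q) n then d ∷ [] else [])
                                          (allLists (length n)))
                      (allLists (length n)))
  where n = norm a

Perfect : Poly → Set
Perfect a = σ a ≈ a

X1 : Poly
X1 = true ∷ true ∷ []

_∘ₚ_ : Poly → Poly → Poly
[] ∘ₚ q = zeroP
(b ∷ p) ∘ₚ q = (if b then oneP else zeroP) +ₚ q *ₚ (p ∘ₚ q)

shift1 : Poly → Poly
shift1 m = m ∘ₚ X1

M5a M5b M16 M20a M20b : Poly
M5a = X *ₚ (X1 ^ₚ 2) *ₚ (true ∷ true ∷ true ∷ [])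
M5b = shift1 M5a
M16 = (X ^ₚ 4) *ₚ (X1 ^ₚ 4) *ₚ (true ∷ false ∷ false ∷ true ∷ true ∷ [])
        *ₚ (true ∷ true ∷ true ∷ true ∷ true ∷ [])
M20a = (X ^ₚ 4) *ₚ (X1 ^ₚ 6) *ₚ (true ∷ true ∷ false ∷ true ∷ [])
         *ₚ (true ∷ false ∷ true ∷ true ∷ [])
         *ₚ (true ∷ true ∷ true ∷ true ∷ true ∷ [])
M20b = shift1 M20a

{-# OPTIONS --safe #-}

-- Put y = x and z = x + 1, and write s(p, n) = 1 + p + ⋯ + pⁿ, so that σ(pⁿ D) = s(p, n) σ(D) for a prime
-- p ∤ D. Perfection reads σ(B²) ∏(1 + Pⱼ) = B² ∏ Pⱼ, and coprimality gives ∏ Pⱼ = σ(B²) R with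
-- B² R = ∏(1 + Pⱼ). Both y and z divide B, so σ(B²) contains the factors U = s(y, 2n) and V = s(z, 2m),
-- and at most one further factor W = s(Q, 2k), since there are at most three primes Pⱼ.
--
-- As (1 + p)(1 + s(p, 2n)) = p (1 + pⁿ)², a third prime factor Q of B, or a nontrivial R, would make
-- Q (1 + Q), respectively R (1 + R), a square up to squares, which is impossible. Hence B = yⁿ zᵐ and
-- every 1 + Pⱼ has the form yⁱ zᶜ.
--
-- If U is one of the primes, then zⁿ = 1 + yⁿ, so n is a power of 2. An explicit trace polynomial G of
-- degree 2n with U ∣ y G (G + yⁿ) then forces U ∈ {G , G + yⁿ}, which fails modulo y² once n ≥ 4; hence n ≤ 2.
-- If U and V are both prime, this gives M16. If V = P P′, then (1 + P)(1 + P′) = y³ z²ᵐ⁻³, and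
-- comparing P P′ with 1 + z + z² + ⋯ modulo z⁴ gives m = 3, which is M20a (or M20b with y and z exchanged).
module Submission where

open import Defs
open import Algebra.Bundles using (CommutativeSemiring; RawRing)
import Algebra.Properties.CommutativeSemiring.Exp
import Algebra.Solver.Ring
open import Algebra.Solver.Ring.AlmostCommutativeRing using (fromCommutativeSemiring; _-Raw-AlmostCommutative⟶_)
open import Algebra.Structures.Biased using (isCommutativeSemiringˡ)
open import Data.Bool using (Bool; true; false; _xor_; _∧_; if_then_else_)
open import Data.Bool.Properties using (xor-assoc; xor-comm; xor-same; xor-identityʳ; ∧-comm; ∧-zeroʳ; ∧-distribˡ-xor; ∧-distribʳ-xor)
import Data.Bool.Properties as Bool
open import Data.Empty using (⊥; ⊥-elim)
open import Data.Fin using (Fin)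
open import Data.List using (List; []; _∷_; length; map; filter; concatMap; foldr; tabulate; _++_)
import Data.List.Properties as List
open import Data.List.Membership.Propositional using (_∈_; lose; find)
open import Data.List.Membership.Propositional.Properties using (∈-map⁺; ∈-map⁻; ∈-filter⁺; ∈-filter⁻; ∈-++⁺ˡ; ∈-++⁺ʳ; ∈-++⁻)
open import Data.List.Membership.Propositional.Properties.WithK using (unique∧set⇒bag)
open import Data.List.Relation.Binary.BagAndSetEquality using (∼bag⇒↭)
open import Data.List.Relation.Binary.Permutation.Propositional using (_↭_; ↭⇒↭ₛ; ↭-refl; ↭-prep; ↭-trans; ↭-sym)
open import Data.List.Relation.Binary.Permutation.Propositional.Properties using (shift; map⁺; ++⁺ˡ; ↭-length; All-resp-↭)
import Data.List.Relation.Binary.Permutation.Setoid.Properties as PermSetoid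
open import Data.List.Relation.Unary.All as All using (All; []; _∷_)
import Data.List.Relation.Unary.All.Properties as All
open import Data.List.Relation.Unary.AllPairs using ([]; _∷_)
open import Data.List.Relation.Unary.Any using (here; there; any?)
open import Data.List.Relation.Unary.Unique.Propositional using (Unique)
import Data.List.Relation.Unary.Unique.Propositional.Properties as Unique
open import Data.Maybe using (Maybe)
open import Data.Nat as ℕ using (ℕ; zero; suc; _≤_; _<_; z≤n; s≤s)
open import Data.Nat.Induction using (<-wellFounded)
import Data.Nat.Properties as ℕ
open import Data.Product using (_,_; _×_; proj₁; proj₂; ∃)
open import Data.Sum using (_⊎_; inj₁; inj₂)
open import Function using (id; mk⇔)
open import Induction.WellFounded using (Acc; acc)
open import Level using (0ℓ)
open import Relation.Binary.Definitions using (tri<; tri≈; tri>)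
open import Relation.Binary.PropositionalEquality using (_≡_; _≢_; refl; sym; trans; cong; cong₂; subst; subst₂; setoid; resp₂; ≢-sym; isEquivalence; module ≡-Reasoning)
open import Relation.Nullary using (¬_; Dec; yes; no)
open import Relation.Nullary.Decidable using (map′; recompute; dec⇒maybe; _×-dec_; ¬?)

-- The ring 𝔽₂[x]

-- The bound r ≤ 3 enters by counting. U, V and a third factor W or R, if present, differ from 1 and
-- multiply into a product of at most three primes, so each of them is then a single Pⱼ. The factors
-- 1 + Pⱼ are thereby known exactly, and the parity of one exponent gives the contradiction. Without
-- a third factor, the primes are distributed over U and V alone, so at least one of these two is
-- itself prime. Both x and x + 1 divide B because an odd Pⱼ is 1 modulo each of them: they divide ∏
-- (1 + Pⱼ) = B² R, but not R, which divides ∏ Pⱼ. The values n = 1 and n = 2 cannot be removed by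
-- the trace polynomial, since there U equals G + yⁿ. For n = m = 1 both U and V are x² + x + 1,
-- which is where distinctness of the Pⱼ decides; n = 1 with a composite V fails by counting
-- exponents of y.

coef : Poly → ℕ → Bool
coef [] i = false
coef (b ∷ p) zero = b
coef (b ∷ p) (suc i) = coef p i

infix 4 _≗ᶜ_
_≗ᶜ_ : (ℕ → Bool) → (ℕ → Bool) → Set
f ≗ᶜ g = ∀ i → f i ≡ g i

coef-consN : ∀ b p → coef (consN b p) ≗ᶜ coef (b ∷ p)
coef-consN false [] zero = refl
coef-consN false [] (suc i) = refl
coef-consN false (_ ∷ _) i = refl
coef-consN true p i = refl

coef-norm : ∀ p → coef (norm p) ≗ᶜ coef p
coef-norm [] i = refl
coef-norm (b ∷ p) i = trans (coef-consN b (norm p) i) (step i)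
  where
  step : coef (b ∷ norm p) ≗ᶜ coef (b ∷ p)
  step zero = refl
  step (suc i) = coef-norm p i

≗⇒≈ : ∀ p q → coef p ≗ᶜ coef q → p ≈ q
≗⇒≈ [] [] e = refl
≗⇒≈ [] (b ∷ q) e rewrite sym (e 0) | sym (≗⇒≈ [] q (λ i → e (suc i))) = refl
≗⇒≈ (b ∷ p) [] e rewrite e 0 | ≗⇒≈ p [] (λ i → e (suc i)) = refl
≗⇒≈ (a ∷ p) (b ∷ q) e = cong₂ consN (e 0) (≗⇒≈ p q (λ i → e (suc i)))

≈⇒≗ : ∀ p q → p ≈ q → coef p ≗ᶜ coef q
≈⇒≗ p q e i = trans (sym (coef-norm p i)) (trans (cong (λ r → coef r i) e) (coef-norm q i))

norm-idem : ∀ p → norm (norm p) ≡ norm p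
norm-idem p = ≗⇒≈ (norm p) p (coef-norm p)

coef-addRaw : ∀ p q i → coef (addRaw p q) i ≡ coef p i xor coef q i
coef-addRaw [] q i = refl
coef-addRaw (a ∷ p) [] i = sym (xor-identityʳ _)
coef-addRaw (a ∷ p) (b ∷ q) zero = refl
coef-addRaw (a ∷ p) (b ∷ q) (suc i) = coef-addRaw p q i

shiftᶜ : (ℕ → Bool) → ℕ → Bool
shiftᶜ g zero = false
shiftᶜ g (suc i) = g i

-- The action of a polynomial on coefficient sequences: multiplication becomes
-- composition of actions, so the ring laws reduce to pointwise Boolean identities.
_·_ : Poly → (ℕ → Bool) → ℕ → Bool
([] · g) i = false
((b ∷ p) · g) i = (b ∧ g i) xor shiftᶜ (p · g) i

shiftᶜ-cong : ∀ {g h} → g ≗ᶜ h → shiftᶜ g ≗ᶜ shiftᶜ h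
shiftᶜ-cong e zero = refl
shiftᶜ-cong e (suc i) = e i

shiftᶜ-coef : ∀ p → coef (false ∷ p) ≗ᶜ shiftᶜ (coef p)
shiftᶜ-coef p zero = refl
shiftᶜ-coef p (suc i) = refl

coef-mulRaw : ∀ p q → coef (mulRaw p q) ≗ᶜ (p · coef q)
coef-mulRaw [] q i = refl
coef-mulRaw (false ∷ p) q i = trans (shiftᶜ-coef (mulRaw p q) i) (shiftᶜ-cong (coef-mulRaw p q) i)
coef-mulRaw (true ∷ p) q i = trans (coef-addRaw q (false ∷ mulRaw p q) i)
  (cong (coef q i xor_) (trans (shiftᶜ-coef (mulRaw p q) i) (shiftᶜ-cong (coef-mulRaw p q) i)))

·-cong : ∀ p {g h} → g ≗ᶜ h → (p · g) ≗ᶜ (p · h)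
·-cong [] e i = refl
·-cong (b ∷ p) e i = cong₂ _xor_ (cong (b ∧_) (e i)) (shiftᶜ-cong (·-cong p e) i)

xor-interchange : ∀ a b c d → (a xor b) xor (c xor d) ≡ (a xor c) xor (b xor d)
xor-interchange a b c d = begin
  (a xor b) xor (c xor d)   ≡⟨ xor-assoc a b (c xor d) ⟩
  a xor (b xor (c xor d))   ≡⟨ cong (a xor_) (xor-assoc b c d) ⟨
  a xor ((b xor c) xor d)   ≡⟨ cong (λ t → a xor (t xor d)) (xor-comm b c) ⟩
  a xor ((c xor b) xor d)   ≡⟨ cong (a xor_) (xor-assoc c b d) ⟩
  a xor (c xor (b xor d))   ≡⟨ xor-assoc a c (b xor d) ⟨
  (a xor c) xor (b xor d)   ∎
  where open ≡-Reasoning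

shiftᶜ-xor : ∀ g h i → shiftᶜ (λ j → g j xor h j) i ≡ shiftᶜ g i xor shiftᶜ h i
shiftᶜ-xor g h zero = refl
shiftᶜ-xor g h (suc i) = refl

·-distribˡ : ∀ p g h i → (p · (λ j → g j xor h j)) i ≡ (p · g) i xor (p · h) i
·-distribˡ [] g h i = refl
·-distribˡ (b ∷ p) g h i = begin
  (b ∧ (g i xor h i)) xor shiftᶜ (p · (λ j → g j xor h j)) i
    ≡⟨ cong₂ _xor_ (∧-distribˡ-xor b (g i) (h i))
         (trans (shiftᶜ-cong (·-distribˡ p g h) i) (shiftᶜ-xor (p · g) (p · h) i)) ⟩
  ((b ∧ g i) xor (b ∧ h i)) xor (shiftᶜ (p · g) i xor shiftᶜ (p · h) i)
    ≡⟨ xor-interchange (b ∧ g i) (b ∧ h i) (shiftᶜ (p · g) i) (shiftᶜ (p · h) i) ⟩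
  ((b ∧ g i) xor shiftᶜ (p · g) i) xor ((b ∧ h i) xor shiftᶜ (p · h) i) ∎
  where open ≡-Reasoning

·-distribʳ : ∀ p q g i → (addRaw p q · g) i ≡ (p · g) i xor (q · g) i
·-distribʳ [] q g i = refl
·-distribʳ (a ∷ p) [] g i = sym (xor-identityʳ _)
·-distribʳ (a ∷ p) (b ∷ q) g i = begin
  ((a xor b) ∧ g i) xor shiftᶜ (addRaw p q · g) i
    ≡⟨ cong₂ _xor_ (∧-distribʳ-xor (g i) a b)
         (trans (shiftᶜ-cong (·-distribʳ p q g) i) (shiftᶜ-xor (p · g) (q · g) i)) ⟩
  ((a ∧ g i) xor (b ∧ g i)) xor (shiftᶜ (p · g) i xor shiftᶜ (q · g) i)
    ≡⟨ xor-interchange (a ∧ g i) (b ∧ g i) (shiftᶜ (p · g) i) (shiftᶜ (q · g) i) ⟩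
  ((a ∧ g i) xor shiftᶜ (p · g) i) xor ((b ∧ g i) xor shiftᶜ (q · g) i) ∎
  where open ≡-Reasoning

·-shift : ∀ p g → (p · shiftᶜ g) ≗ᶜ shiftᶜ (p · g)
·-shift [] g zero = refl
·-shift [] g (suc i) = refl
·-shift (b ∷ p) g zero = cong (_xor false) (∧-zeroʳ b)
·-shift (b ∷ p) g (suc i) = cong ((b ∧ g i) xor_) (·-shift p g i)

·-assoc : ∀ p q g → (mulRaw p q · g) ≗ᶜ (p · (q · g))
·-assoc [] q g i = refl
·-assoc (false ∷ p) q g i = shiftᶜ-cong (·-assoc p q g) i
·-assoc (true ∷ p) q g i = trans (·-distribʳ q (false ∷ mulRaw p q) g i)
  (cong ((q · g) i xor_) (shiftᶜ-cong (·-assoc p q g) i))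

·-zeroʳ : ∀ p i → (p · (λ _ → false)) i ≡ false
·-zeroʳ [] i = refl
·-zeroʳ (b ∷ p) zero = cong (_xor false) (∧-zeroʳ b)
·-zeroʳ (b ∷ p) (suc i) = trans (cong (_xor (p · (λ _ → false)) i) (∧-zeroʳ b)) (·-zeroʳ p i)

·-const : ∀ p b i → (p · coef (b ∷ [])) i ≡ b ∧ coef p i
·-const [] b i = sym (∧-zeroʳ b)
·-const (a ∷ p) b zero = trans (xor-identityʳ _) (∧-comm a b)
·-const (a ∷ p) b (suc i) = trans (cong (_xor (p · coef (b ∷ [])) i) (∧-zeroʳ a)) (·-const p b i)

coef-∷ : ∀ b p i → coef (b ∷ p) i ≡ coef (b ∷ []) i xor shiftᶜ (coef p) i
coef-∷ b p zero = sym (xor-identityʳ b)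
coef-∷ b p (suc i) = refl

·-comm : ∀ p q → (p · coef q) ≗ᶜ (q · coef p)
·-comm [] q i = sym (·-zeroʳ q i)
·-comm (b ∷ p) q i = sym (begin
  (q · coef (b ∷ p)) i
    ≡⟨ ·-cong q (coef-∷ b p) i ⟩
  (q · (λ j → coef (b ∷ []) j xor shiftᶜ (coef p) j)) i
    ≡⟨ ·-distribˡ q (coef (b ∷ [])) (shiftᶜ (coef p)) i ⟩
  (q · coef (b ∷ [])) i xor (q · shiftᶜ (coef p)) i
    ≡⟨ cong₂ _xor_ (·-const q b i) (trans (·-shift q (coef p) i) (shiftᶜ-cong (λ j → sym (·-comm p q j)) i)) ⟩
  (b ∧ coef q i) xor shiftᶜ (p · coef q) i ∎)
  where open ≡-Reasoning

-- Storing normal forms turns `_≈_` into propositional equality, so rewriting and the ring solver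
-- apply directly. Irrelevance of `normal` makes elements with the same list equal by `refl`.
record 𝔽₂[x] : Set where
  constructor mk
  field
    poly    : Poly
    .normal : norm poly ≡ poly

open 𝔽₂[x]

_≟ᵖ_ : (p q : Poly) → Dec (p ≡ q)
_≟ᵖ_ = List.≡-dec Bool._≟_

poly-injective : ∀ {f g} → poly f ≡ poly g → f ≡ g
poly-injective refl = refl

_≟_ : (f g : 𝔽₂[x]) → Dec (f ≡ g)
f ≟ g = map′ poly-injective (cong poly) (poly f ≟ᵖ poly g)

[_] : Poly → 𝔽₂[x]
[ p ] = mk (norm p) (norm-idem p)

[]-cong : ∀ p q → p ≈ q → [ p ] ≡ [ q ]
[]-cong p q = poly-injective

[]-injective : ∀ p q → [ p ] ≡ [ q ] → p ≈ q
[]-injective p q = cong poly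

opaque
  [poly] : ∀ f → [ poly f ] ≡ f
  [poly] (mk p n) = poly-injective (recompute (_ ≟ᵖ _) n)

infix 8 _⟨_⟩
_⟨_⟩ : 𝔽₂[x] → ℕ → Bool
f ⟨ i ⟩ = coef (poly f) i

opaque
  coefs-injective : ∀ {f g} → (∀ i → f ⟨ i ⟩ ≡ g ⟨ i ⟩) → f ≡ g
  coefs-injective {f} {g} e = trans (sym ([poly] f)) (trans ([]-cong (poly f) (poly g) (≗⇒≈ (poly f) (poly g) e)) ([poly] g))

infixl 6 _+_
infixl 7 _*_

opaque
  -- Opaque, so that expressions are compared by their algebraic form. They are unfolded only to
  -- derive the coefficient laws and to evaluate explicit polynomials.
  _+_ _*_ : 𝔽₂[x] → 𝔽₂[x] → 𝔽₂[x]
  f + g = [ addRaw (poly f) (poly g) ]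
  f * g = [ mulRaw (poly f) (poly g) ]

0# 1# x x+1 : 𝔽₂[x]
0# = [ zeroP ]
1# = [ oneP ]
x = [ X ]
x+1 = [ X1 ]

opaque
  unfolding _+_ _*_

  coef-+ : ∀ f g i → (f + g) ⟨ i ⟩ ≡ f ⟨ i ⟩ xor g ⟨ i ⟩
  coef-+ f g i = trans (coef-norm (addRaw (poly f) (poly g)) i) (coef-addRaw (poly f) (poly g) i)

  coef-* : ∀ f g → coef (poly (f * g)) ≗ᶜ (poly f · coef (poly g))
  coef-* f g i = trans (coef-norm (mulRaw (poly f) (poly g)) i) (coef-mulRaw (poly f) (poly g) i)

  *-assoc : ∀ f g h → (f * g) * h ≡ f * (g * h)
  *-assoc f g h = coefs-injective λ i → begin
    ((f * g) * h) ⟨ i ⟩                          ≡⟨ coef-* (f * g) h i ⟩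
    (poly (f * g) · coef (poly h)) i             ≡⟨ ·-comm (poly (f * g)) (poly h) i ⟩
    (poly h · coef (poly (f * g))) i             ≡⟨ ·-cong (poly h) (coef-norm (mulRaw (poly f) (poly g))) i ⟩
    (poly h · coef (mulRaw (poly f) (poly g))) i ≡⟨ ·-comm (poly h) (mulRaw (poly f) (poly g)) i ⟩
    (mulRaw (poly f) (poly g) · coef (poly h)) i ≡⟨ ·-assoc (poly f) (poly g) (coef (poly h)) i ⟩
    (poly f · (poly g · coef (poly h))) i        ≡⟨ ·-cong (poly f) (coef-* g h) i ⟨
    (poly f · coef (poly (g * h))) i             ≡⟨ coef-* f (g * h) i ⟨
    (f * (g * h)) ⟨ i ⟩                          ∎
    where open ≡-Reasoning

  [+ₚ] : ∀ p q → [ p +ₚ q ] ≡ [ p ] + [ q ]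
  [+ₚ] p q = coefs-injective λ i → begin
    coef (norm (norm (addRaw p q))) i    ≡⟨ coef-norm (norm (addRaw p q)) i ⟩
    coef (norm (addRaw p q)) i           ≡⟨ coef-norm (addRaw p q) i ⟩
    coef (addRaw p q) i                  ≡⟨ coef-addRaw p q i ⟩
    coef p i xor coef q i                ≡⟨ cong₂ _xor_ (coef-norm p i) (coef-norm q i) ⟨
    coef (norm p) i xor coef (norm q) i  ≡⟨ coef-+ [ p ] [ q ] i ⟨
    ([ p ] + [ q ]) ⟨ i ⟩                ∎
    where open ≡-Reasoning

  [*ₚ] : ∀ p q → [ p *ₚ q ] ≡ [ p ] * [ q ]
  [*ₚ] p q = coefs-injective λ i → begin
    coef (norm (norm (mulRaw p q))) i    ≡⟨ coef-norm (norm (mulRaw p q)) i ⟩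
    coef (norm (mulRaw p q)) i           ≡⟨ coef-norm (mulRaw p q) i ⟩
    coef (mulRaw p q) i                  ≡⟨ coef-mulRaw p q i ⟩
    (p · coef q) i                       ≡⟨ ·-comm p q i ⟩
    (q · coef p) i                       ≡⟨ ·-cong q (coef-norm p) i ⟨
    (q · coef (norm p)) i                ≡⟨ ·-comm q (norm p) i ⟩
    (norm p · coef q) i                  ≡⟨ ·-cong (norm p) (coef-norm q) i ⟨
    (norm p · coef (norm q)) i           ≡⟨ coef-* [ p ] [ q ] i ⟨
    ([ p ] * [ q ]) ⟨ i ⟩                ∎
    where open ≡-Reasoning

opaque
  +-assoc : ∀ f g h → (f + g) + h ≡ f + (g + h)
  +-assoc f g h = coefs-injective λ i → begin
    ((f + g) + h) ⟨ i ⟩                  ≡⟨ coef-+ (f + g) h i ⟩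
    (f + g) ⟨ i ⟩ xor h ⟨ i ⟩            ≡⟨ cong (_xor h ⟨ i ⟩) (coef-+ f g i) ⟩
    (f ⟨ i ⟩ xor g ⟨ i ⟩) xor h ⟨ i ⟩    ≡⟨ xor-assoc (f ⟨ i ⟩) (g ⟨ i ⟩) (h ⟨ i ⟩) ⟩
    f ⟨ i ⟩ xor (g ⟨ i ⟩ xor h ⟨ i ⟩)    ≡⟨ cong (f ⟨ i ⟩ xor_) (coef-+ g h i) ⟨
    f ⟨ i ⟩ xor (g + h) ⟨ i ⟩            ≡⟨ coef-+ f (g + h) i ⟨
    (f + (g + h)) ⟨ i ⟩                  ∎
    where open ≡-Reasoning

opaque
  +-comm : ∀ f g → f + g ≡ g + f
  +-comm f g = coefs-injective λ i →
    trans (coef-+ f g i) (trans (xor-comm (f ⟨ i ⟩) (g ⟨ i ⟩)) (sym (coef-+ g f i)))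

opaque
  +-identityˡ : ∀ f → 0# + f ≡ f
  +-identityˡ f = coefs-injective (coef-+ 0# f)

opaque
  +-self : ∀ f → f + f ≡ 0#
  +-self f = coefs-injective λ i → trans (coef-+ f f i) (xor-same (f ⟨ i ⟩))

opaque
  *-comm : ∀ f g → f * g ≡ g * f
  *-comm f g = coefs-injective λ i →
    trans (coef-* f g i) (trans (·-comm (poly f) (poly g) i) (sym (coef-* g f i)))

opaque
  *-identityˡ : ∀ f → 1# * f ≡ f
  *-identityˡ f = coefs-injective λ i → trans (coef-* 1# f i) (step i)
    where
    step : (oneP · coef (poly f)) ≗ᶜ coef (poly f)
    step zero = xor-identityʳ _
    step (suc i) = xor-identityʳ _

opaque
  *-zeroˡ : ∀ f → 0# * f ≡ 0#
  *-zeroˡ f = coefs-injective (coef-* 0# f)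

opaque
  *-distribˡ-+ : ∀ f g h → f * (g + h) ≡ f * g + f * h
  *-distribˡ-+ f g h = coefs-injective λ i → begin
    (f * (g + h)) ⟨ i ⟩                                         ≡⟨ coef-* f (g + h) i ⟩
    (poly f · coef (poly (g + h))) i                            ≡⟨ ·-cong (poly f) (coef-+ g h) i ⟩
    (poly f · (λ j → g ⟨ j ⟩ xor h ⟨ j ⟩)) i                    ≡⟨ ·-distribˡ (poly f) (coef (poly g)) (coef (poly h)) i ⟩
    (poly f · coef (poly g)) i xor (poly f · coef (poly h)) i   ≡⟨ cong₂ _xor_ (coef-* f g i) (coef-* f h i) ⟨
    (f * g) ⟨ i ⟩ xor (f * h) ⟨ i ⟩                             ≡⟨ coef-+ (f * g) (f * h) i ⟨
    (f * g + f * h) ⟨ i ⟩                                       ∎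
    where open ≡-Reasoning

commutativeSemiring : CommutativeSemiring 0ℓ 0ℓ
commutativeSemiring = record
  { Carrier = 𝔽₂[x] ; _≈_ = _≡_ ; _+_ = _+_ ; _*_ = _*_ ; 0# = 0# ; 1# = 1#
  ; isCommutativeSemiring = isCommutativeSemiringˡ record
    { +-isCommutativeMonoid = record
      { isMonoid = record
        { isSemigroup = record
          { isMagma = record { isEquivalence = isEquivalence ; ∙-cong = cong₂ _+_ }
          ; assoc = +-assoc }
        ; identity = +-identityˡ , λ f → trans (+-comm f 0#) (+-identityˡ f) }
      ; comm = +-comm }
    ; *-isCommutativeMonoid = record
      { isMonoid = record
        { isSemigroup = record
          { isMagma = record { isEquivalence = isEquivalence ; ∙-cong = cong₂ _*_ }
          ; assoc = *-assoc }
        ; identity = *-identityˡ , λ f → trans (*-comm f 1#) (*-identityˡ f) }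
      ; comm = *-comm }
    ; distribʳ = λ f g h → trans (*-comm (g + h) f)
        (trans (*-distribˡ-+ f g h) (cong₂ _+_ (*-comm f g) (*-comm f h)))
    ; zeroˡ = *-zeroˡ
    }
  }

open CommutativeSemiring commutativeSemiring
  using (+-isCommutativeMonoid; *-isCommutativeMonoid; +-identityʳ; *-identityʳ; zeroʳ)
open Algebra.Properties.CommutativeSemiring.Exp commutativeSemiring
  using (_^_; ^-homo-*)

const : Bool → 𝔽₂[x]
const b = [ b ∷ [] ]

const-+ : ∀ a b → const (a xor b) ≡ const a + const b
const-+ true true = sym (+-self 1#)
const-+ true false = sym (trans (+-comm 1# 0#) (+-identityˡ 1#))
const-+ false b = sym (+-identityˡ (const b))

const-* : ∀ a b → const (a ∧ b) ≡ const a * const b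
const-* true b = sym (*-identityˡ (const b))
const-* false b = sym (*-zeroˡ (const b))

const-injective : ∀ a b → const a ≡ const b → a ≡ b
const-injective true true _ = refl
const-injective false false _ = refl

-- Taking the coefficients of the solver in Bool rather than ℕ makes it decide
-- identities of characteristic 2.
𝔽₂ : RawRing 0ℓ 0ℓ
𝔽₂ = record { Carrier = Bool ; _≈_ = _≡_ ; _+_ = _xor_ ; _*_ = _∧_ ; -_ = id ; 0# = false ; 1# = true }

const-morphism : 𝔽₂ -Raw-AlmostCommutative⟶ fromCommutativeSemiring commutativeSemiring
const-morphism = record
  { ⟦_⟧ = const ; +-homo = const-+ ; *-homo = const-* ; -‿homo = λ _ → refl
  ; 0-homo = refl ; 1-homo = refl }

const-≟ : ∀ a b → Maybe (const a ≡ const b)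
const-≟ a b = dec⇒maybe (map′ (cong const) (const-injective a b) (a Bool.≟ b))

module Solver = Algebra.Solver.Ring 𝔽₂ (fromCommutativeSemiring commutativeSemiring) const-morphism const-≟

open Solver using (solve; _:+_; _:*_; _:^_; _:=_; con)

-- Degree, division with remainder, primes

HasDegᶜ : (ℕ → Bool) → ℕ → Set
HasDegᶜ c n = c n ≡ true × (∀ i → n < i → c i ≡ false)

HasDeg : 𝔽₂[x] → ℕ → Set
HasDeg f = HasDegᶜ (coef (poly f))

consN-tail : ∀ b q r → consN b q ≡ b ∷ r → q ≡ r
consN-tail false (_ ∷ _) r refl = refl
consN-tail true q r refl = refl

normal⇒HasDegᶜ : ∀ b p → norm (b ∷ p) ≡ b ∷ p → HasDegᶜ (coef (b ∷ p)) (length p)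
normal⇒HasDegᶜ true [] e = refl , λ { (suc i) _ → refl }
normal⇒HasDegᶜ b (c ∷ p) e with normal⇒HasDegᶜ c p (consN-tail b (norm (c ∷ p)) (c ∷ p) e)
... | top , above = top , λ { (suc i) (s≤s n<i) → above i n<i }

-- The zero polynomial receives degree 0, which is why laws such as `deg-*` carry nonvanishing
-- hypotheses.
deg : 𝔽₂[x] → ℕ
deg f = ℕ.pred (length (poly f))

hasDeg : ∀ f → f ≢ 0# → HasDeg f (deg f)
hasDeg (mk [] n) f≢0 = ⊥-elim (f≢0 refl)
hasDeg (mk (b ∷ p) n) f≢0 = normal⇒HasDegᶜ b p (recompute (_ ≟ᵖ _) n)

HasDegᶜ-unique : ∀ {c m n} → HasDegᶜ c m → HasDegᶜ c n → m ≡ n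
HasDegᶜ-unique {c} {m} {n} (cm , am) (cn , an) with ℕ.<-cmp m n
... | tri≈ _ e _ = e
... | tri< m<n _ _ with () ← trans (sym cn) (am n m<n)
... | tri> _ _ n<m with () ← trans (sym cm) (an m n<m)

HasDeg⇒≢0 : ∀ {f n} → HasDeg f n → f ≢ 0#
HasDeg⇒≢0 () refl

HasDeg⇒deg : ∀ {f n} → HasDeg f n → deg f ≡ n
HasDeg⇒deg {f} d = HasDegᶜ-unique (hasDeg f (HasDeg⇒≢0 {f} d)) d

·-zeroˡ : ∀ p g → (∀ i → coef p i ≡ false) → ∀ i → (p · g) i ≡ false
·-zeroˡ [] g e i = refl
·-zeroˡ (b ∷ p) g e i rewrite e 0 = trans (shiftᶜ-cong (·-zeroˡ p g (λ j → e (suc j))) i) (shift0 i)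
  where
  shift0 : ∀ i → shiftᶜ (λ _ → false) i ≡ false
  shift0 zero = refl
  shift0 (suc i) = refl

-- Induction on the leading index of `p`. At index 0 the list may still have a tail, but all its
-- coefficients vanish. In the step, positions beyond the degree of `g` see only the shifted product
-- of the tail.
HasDegᶜ-· : ∀ p n g m → HasDegᶜ (coef p) n → HasDegᶜ g m → HasDegᶜ (p · g) (n ℕ.+ m)
HasDegᶜ-· (b ∷ p) zero g m (refl , ap) (cg , ag) = trans (eq m) cg , λ i m<i → trans (eq i) (ag i m<i)
  where
  eq : ∀ i → ((true ∷ p) · g) i ≡ g i
  eq zero = xor-identityʳ _
  eq (suc i) = trans (cong (g (suc i) xor_) (·-zeroˡ p g (λ j → ap (suc j) (s≤s z≤n)) i)) (xor-identityʳ _)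
HasDegᶜ-· (b ∷ p) (suc n) g m (cp , ap) (cg , ag)
  with HasDegᶜ-· p n g m (cp , λ i n<i → ap (suc i) (s≤s n<i)) (cg , ag)
... | top , above = trans (eq (n ℕ.+ m) ℕ.≤-refl) top ,
                    λ { (suc i) (s≤s n<i) → trans (eq i (ℕ.<⇒≤ n<i)) (above i n<i) }
  where
  eq : ∀ i → n ℕ.+ m ≤ i → ((b ∷ p) · g) (suc i) ≡ (p · g) i
  eq i le = cong (_xor (p · g) i)
    (trans (cong (b ∧_) (ag (suc i) (s≤s (ℕ.≤-trans (ℕ.m≤n+m m n) le)))) (∧-zeroʳ b))

HasDeg-* : ∀ {f g m n} → HasDeg f m → HasDeg g n → HasDeg (f * g) (m ℕ.+ n)
HasDeg-* {f} {g} {m} {n} df dg with HasDegᶜ-· (poly f) m (coef (poly g)) n df dg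
... | top , above = trans (coef-* f g _) top , λ i lt → trans (coef-* f g i) (above i lt)

*-≢0 : ∀ {f g} → f ≢ 0# → g ≢ 0# → f * g ≢ 0#
*-≢0 {f} {g} f≢0 g≢0 = HasDeg⇒≢0 {f * g} (HasDeg-* {f} {g} (hasDeg f f≢0) (hasDeg g g≢0))

deg-* : ∀ {f g} → f ≢ 0# → g ≢ 0# → deg (f * g) ≡ deg f ℕ.+ deg g
deg-* {f} {g} f≢0 g≢0 = HasDeg⇒deg {f * g} (HasDeg-* {f} {g} (hasDeg f f≢0) (hasDeg g g≢0))

HasDeg-^ : ∀ {f} → HasDeg f 1 → ∀ n → HasDeg (f ^ n) n
HasDeg-^ d zero = refl , λ { (suc i) _ → refl }
HasDeg-^ {f} d (suc n) = HasDeg-* {f} {f ^ n} d (HasDeg-^ {f} d n)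

opaque
  deg≡0⇒≡1 : ∀ {f} → f ≢ 0# → deg f ≡ 0 → f ≡ 1#
  deg≡0⇒≡1 {f} f≢0 d with subst (HasDeg f) d (hasDeg f f≢0)
  ... | top , above = coefs-injective λ { zero → top ; (suc i) → above (suc i) (s≤s z≤n) }

1≢0 : 1# ≢ 0#
1≢0 ()

opaque
  *≡1⇒≡1 : ∀ {f g} → f * g ≡ 1# → g ≡ 1#
  *≡1⇒≡1 {f} {g} e = deg≡0⇒≡1 g≢0 (ℕ.m+n≡0⇒n≡0 (deg f) (trans (sym (deg-* f≢0 g≢0)) (cong deg e)))
    where
    f≢0 : f ≢ 0#
    f≢0 refl = 1≢0 (trans (sym e) (*-zeroˡ g))
    g≢0 : g ≢ 0#
    g≢0 refl = 1≢0 (trans (sym e) (zeroʳ f))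

opaque
  +≡0⇒≡ : ∀ {f g} → f + g ≡ 0# → f ≡ g
  +≡0⇒≡ {f} {g} e = begin
    f            ≡⟨ solve 2 (λ f g → f := f :+ g :+ g) refl f g ⟩
    f + g + g    ≡⟨ cong (_+ g) e ⟩
    0# + g       ≡⟨ +-identityˡ g ⟩
    g            ∎
    where open ≡-Reasoning

opaque
  +-move : ∀ {f g h} → f + g ≡ h → f ≡ h + g
  +-move {f} {g} e = trans (solve 2 (λ f g → f := f :+ g :+ g) refl f g) (cong (_+ g) e)

opaque
  *-cancelˡ : ∀ h {f g} → h ≢ 0# → h * f ≡ h * g → f ≡ g
  *-cancelˡ h {f} {g} h≢0 e with (f + g) ≟ 0#
  ... | yes e′ = +≡0⇒≡ e′
  ... | no ≢0 = ⊥-elim (*-≢0 h≢0 ≢0 (trans (*-distribˡ-+ h f g) (trans (cong (_+ h * g) e) (+-self (h * g)))))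

opaque
  square-injective : ∀ {f g} → f * f ≡ g * g → f ≡ g
  square-injective {f} {g} e with (f + g) ≟ 0#
  ... | yes e′ = +≡0⇒≡ e′
  ... | no ≢0 = ⊥-elim (*-≢0 ≢0 ≢0 (begin
    (f + g) * (f + g)   ≡⟨ solve 2 (λ f g → (f :+ g) :* (f :+ g) := f :* f :+ g :* g) refl f g ⟩
    f * f + g * g       ≡⟨ cong (_+ g * g) e ⟩
    g * g + g * g       ≡⟨ +-self (g * g) ⟩
    0#                  ∎))
    where open ≡-Reasoning

infix 4 _∣ᶠ_
_∣ᶠ_ : 𝔽₂[x] → 𝔽₂[x] → Set
d ∣ᶠ f = ∃ λ q → f ≡ q * d

∣-refl : ∀ {f} → f ∣ᶠ f
∣-refl {f} = 1# , sym (*-identityˡ f)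

∣-trans : ∀ {f g h} → f ∣ᶠ g → g ∣ᶠ h → f ∣ᶠ h
∣-trans {f} (q , refl) (r , refl) = r * q , sym (*-assoc r q f)

∣-* : ∀ {f g} h → f ∣ᶠ g → f ∣ᶠ h * g
∣-* {f} h (q , refl) = h * q , sym (*-assoc h q f)

m∣m*n : ∀ {f} h → f ∣ᶠ f * h
m∣m*n {f} h = h , *-comm f h

opaque
  ∣-+ : ∀ {d f g} → d ∣ᶠ f → d ∣ᶠ g → d ∣ᶠ f + g
  ∣-+ {d} (q , refl) (r , refl) =
    q + r , solve 3 (λ q r d → q :* d :+ r :* d := (q :+ r) :* d) refl q r d

∣0 : ∀ {d} → d ∣ᶠ 0#
∣0 {d} = 0# , sym (*-zeroˡ d)

∣1⇒≡1 : ∀ {d} → d ∣ᶠ 1# → d ≡ 1#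
∣1⇒≡1 (q , e) = *≡1⇒≡1 (sym e)

∣⇒≢0 : ∀ {d f} → f ≢ 0# → d ∣ᶠ f → d ≢ 0#
∣⇒≢0 f≢0 (q , refl) refl = f≢0 (zeroʳ q)

∣⇒deg≤ : ∀ {d f} → f ≢ 0# → d ∣ᶠ f → deg d ≤ deg f
∣⇒deg≤ {d} f≢0 (q , refl) =
  subst (deg d ≤_) (sym (deg-* (λ { refl → f≢0 (*-zeroˡ d) }) (∣⇒≢0 f≢0 (q , refl)))) (ℕ.m≤n+m (deg d) (deg q))

opaque
  ∣∧deg≤⇒≡ : ∀ {d f} → f ≢ 0# → d ∣ᶠ f → deg f ≤ deg d → d ≡ f
  ∣∧deg≤⇒≡ {d} f≢0 (q , refl) le = sym (trans (cong (_* d) q≡1) (*-identityˡ d))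
    where
    q≢0 : q ≢ 0#
    q≢0 refl = f≢0 (*-zeroˡ d)
    q≡1 : q ≡ 1#
    q≡1 = deg≡0⇒≡1 q≢0 (ℕ.n≤0⇒n≡0 (ℕ.+-cancelʳ-≤ (deg d) (deg q) 0
            (subst (_≤ deg d) (deg-* q≢0 (∣⇒≢0 f≢0 (q , refl))) le)))

-- Unlike `deg f < n`, this bound also admits the zero polynomial at n = 0, as the remainder of a
-- division by 1 requires.
DegBelow : ℕ → 𝔽₂[x] → Set
DegBelow n f = ∀ i → n ≤ i → f ⟨ i ⟩ ≡ false

DegBelow⇒deg< : ∀ {n f} → DegBelow n f → f ≢ 0# → deg f < n
DegBelow⇒deg< {n} {f} b f≢0 with deg f ℕ.<? n
... | yes lt = lt
... | no ≮ with () ← trans (sym (proj₁ (hasDeg f f≢0))) (b (deg f) (ℕ.≮⇒≥ ≮))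

DegBelow-+ : ∀ {n f g} → DegBelow n f → DegBelow n g → DegBelow n (f + g)
DegBelow-+ {f = f} {g} bf bg i le = trans (coef-+ f g i) (cong₂ _xor_ (bf i le) (bg i le))

DegBelow-pred : ∀ {n f} → DegBelow (suc n) f → f ⟨ n ⟩ ≡ false → DegBelow n f
DegBelow-pred {n} b fn i le with ℕ.m≤n⇒m<n∨m≡n le
... | inj₁ lt = b i lt
... | inj₂ refl = fn

coef-x* : ∀ f i → (x * f) ⟨ i ⟩ ≡ shiftᶜ (coef (poly f)) i
coef-x* f i = trans (coef-* x f i) (shiftᶜ-cong one i)
  where
  one : (oneP · coef (poly f)) ≗ᶜ coef (poly f)
  one zero = xor-identityʳ _
  one (suc i) = xor-identityʳ _

[∷] : ∀ b p → [ b ∷ p ] ≡ const b + x * [ p ]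
[∷] b p = coefs-injective λ i → trans (coef-norm (b ∷ p) i) (trans (coef-∷ b p i)
  (sym (trans (coef-+ (const b) (x * [ p ]) i) (cong₂ _xor_ (coef-norm (b ∷ []) i)
    (trans (coef-x* [ p ] i) (shiftᶜ-cong (coef-norm p) i))))))

DegBelow-∷ : ∀ {n r} b → DegBelow n r → DegBelow (suc n) (const b + x * r)
DegBelow-∷ {n} {r} b d (suc i) (s≤s le) = trans (coef-+ (const b) (x * r) (suc i))
  (cong₂ _xor_ (coef-norm (b ∷ []) (suc i)) (trans (coef-x* r (suc i)) (d i le)))

DivMod : 𝔽₂[x] → 𝔽₂[x] → Set
DivMod f g = ∃ λ q → ∃ λ r → f ≡ q * g + r × DegBelow (deg g) r

opaque
  -- Horner's scheme: if `r` is the remainder of the tail, then b + x r has degree at most that of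
  -- `g`, and its coefficient at `deg g` tells whether one copy of `g` must be added.
  divMod : ∀ f g → g ≢ 0# → DivMod f g
  divMod f g g≢0 = subst (λ t → DivMod t g) ([poly] f) (go (poly f))
    where
    go : ∀ p → DivMod [ p ] g
    go [] = 0# , 0# , sym (trans (+-identityʳ _) (*-zeroˡ g)) , λ _ _ → refl
    go (b ∷ p) with go p
    ... | q , r , e , d with (const b + x * r) ⟨ deg g ⟩ in top
    ...   | false = x * q , const b + x * r ,
                    trans ([∷] b p) (trans (cong (λ t → const b + x * t) e)
                      (solve 5 (λ c x q g r → c :+ x :* (q :* g :+ r) := x :* q :* g :+ (c :+ x :* r))
                        refl (const b) x q g r)) ,
                    DegBelow-pred {f = const b + x * r} (DegBelow-∷ {r = r} b d) top
    ...   | true = 1# + x * q , const b + x * r + g ,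
                   trans ([∷] b p) (trans (cong (λ t → const b + x * t) e)
                     (solve 5 (λ c x q g r → c :+ x :* (q :* g :+ r) :=
                                             (con true :+ x :* q) :* g :+ (c :+ x :* r :+ g))
                        refl (const b) x q g r)) ,
                   DegBelow-pred {f = const b + x * r + g}
                     (DegBelow-+ {f = const b + x * r} {g} (DegBelow-∷ {r = r} b d) (proj₂ (hasDeg g g≢0)))
                     (trans (coef-+ (const b + x * r) g (deg g)) (cong₂ _xor_ top (proj₁ (hasDeg g g≢0))))

opaque
  -- A nonzero remainder refutes divisibility, because it would be a multiple of `d` of smaller
  -- degree. Deciding divisibility stands in for excluded middle in `euclid`, `valuation` and the
  -- list of divisors.
  _∣?_ : ∀ d f → Dec (d ∣ᶠ f)
  d ∣? f with d ≟ 0#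
  ... | yes refl = map′ (λ { refl → ∣0 }) (λ { (q , refl) → zeroʳ q }) (f ≟ 0#)
  ... | no d≢0 with divMod f d d≢0
  ...   | q , r , refl , b with r ≟ 0#
  ...     | yes refl = yes (q , +-identityʳ _)
  ...     | no r≢0 = no λ { (q′ , e) → ℕ.<⇒≱ (DegBelow⇒deg< {f = r} b r≢0) (∣⇒deg≤ r≢0
                       (q + q′ , trans (+-move (trans (+-comm r (q * d)) e))
                          (solve 3 (λ q q′ d → q′ :* d :+ q :* d := (q :+ q′) :* d) refl q q′ d))) }

opaque
  bezout : ∀ f g → ∃ λ d → ∃ λ u → ∃ λ v → d ∣ᶠ f × d ∣ᶠ g × d ≡ u * f + v * g
  bezout f g = go f g (<-wellFounded (deg g))
    where
    go : ∀ f g → Acc _<_ (deg g) → ∃ λ d → ∃ λ u → ∃ λ v → d ∣ᶠ f × d ∣ᶠ g × d ≡ u * f + v * g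
    go f g (acc rec) with g ≟ 0#
    ... | yes refl = f , 1# , 0# , ∣-refl , ∣0 ,
                     solve 1 (λ f → f := con true :* f :+ con false :* con false) refl f
    ... | no g≢0 with divMod f g g≢0
    ...   | q , r , refl , b with r ≟ 0#
    ...     | yes refl = g , 0# , 1# , (q , +-identityʳ _) , ∣-refl ,
                         solve 2 (λ g f → g := con false :* f :+ con true :* g) refl g (q * g + 0#)
    ...     | no r≢0 with go g r (rec (DegBelow⇒deg< {f = r} b r≢0))
    ...       | d , u , v , d∣g , d∣r , e =
      d , v , u + v * q , ∣-+ (∣-* q d∣g) d∣r , d∣g ,
      trans e (solve 5 (λ u v q g r → u :* g :+ v :* r := v :* (q :* g :+ r) :+ (u :+ v :* q) :* g) refl u v q g r)

Coprime : 𝔽₂[x] → 𝔽₂[x] → Set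
Coprime f g = ∃ λ u → ∃ λ v → 1# ≡ u * f + v * g

opaque
  coprime-divides : ∀ {d p f} → Coprime d p → d ∣ᶠ p * f → d ∣ᶠ f
  coprime-divides {d} {p} {f} (u , v , e) (q , e′) = u * f + v * q , (begin
    f                          ≡⟨ *-identityˡ f ⟨
    1# * f                     ≡⟨ cong (_* f) e ⟩
    (u * d + v * p) * f        ≡⟨ solve 5 (λ u d v p f → (u :* d :+ v :* p) :* f := u :* f :* d :+ v :* (p :* f)) refl u d v p f ⟩
    u * f * d + v * (p * f)    ≡⟨ cong (λ t → u * f * d + v * t) e′ ⟩
    u * f * d + v * (q * d)    ≡⟨ solve 5 (λ u d v q f → u :* f :* d :+ v :* (q :* d) := (u :* f :+ v :* q) :* d) refl u d v q f ⟩
    (u * f + v * q) * d        ∎)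
    where open ≡-Reasoning

Prime : 𝔽₂[x] → Set
Prime p = p ≢ 0# × p ≢ 1# × (∀ d → d ∣ᶠ p → d ≡ 1# ⊎ d ≡ p)

opaque
  ∤⇒coprime : ∀ {p f} → Prime p → ¬ p ∣ᶠ f → Coprime f p
  ∤⇒coprime {p} {f} (_ , _ , irr) p∤f with bezout f p
  ... | d , u , v , d∣f , d∣p , e with irr d d∣p
  ...   | inj₁ refl = u , v , e
  ...   | inj₂ refl = ⊥-elim (p∤f d∣f)

coprime-sym : ∀ {f g} → Coprime f g → Coprime g f
coprime-sym {f} {g} (u , v , e) = v , u , trans e (+-comm (u * f) (v * g))

opaque
  euclid : ∀ {p f g} → Prime p → p ∣ᶠ f * g → p ∣ᶠ f ⊎ p ∣ᶠ g
  euclid {p} {f} pr d with p ∣? f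
  ... | yes p∣f = inj₁ p∣f
  ... | no p∤f = inj₂ (coprime-divides (coprime-sym {f} {p} (∤⇒coprime pr p∤f)) d)

prime∣square : ∀ {p f} → Prime p → p ∣ᶠ f * f → p ∣ᶠ f
prime∣square pr d with euclid pr d
... | inj₁ h = h
... | inj₂ h = h

prime∤1 : ∀ {p} → Prime p → ¬ p ∣ᶠ 1#
prime∤1 (_ , p≢1 , _) d = p≢1 (∣1⇒≡1 d)

prime-∣^ : ∀ {p f} → Prime p → ∀ n → p ∣ᶠ f ^ n → p ∣ᶠ f
prime-∣^ pr zero d = ⊥-elim (prime∤1 pr d)
prime-∣^ pr (suc n) d with euclid pr d
... | inj₁ h = h
... | inj₂ h = prime-∣^ pr n h

deg1⇒prime : ∀ {p} → HasDeg p 1 → Prime p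
deg1⇒prime {p} d = p≢0 , (λ { refl → case1 (proj₁ d) }) , irr
  where
  case1 : false ≡ true → ⊥
  case1 ()
  p≢0 : p ≢ 0#
  p≢0 = HasDeg⇒≢0 {p} d
  irr : ∀ e → e ∣ᶠ p → e ≡ 1# ⊎ e ≡ p
  irr e e∣p with deg e in de
  ... | zero = inj₁ (deg≡0⇒≡1 (∣⇒≢0 p≢0 e∣p) de)
  ... | suc n = inj₂ (∣∧deg≤⇒≡ p≢0 e∣p
                  (subst₂ _≤_ (sym (HasDeg⇒deg {p} d)) (sym de) (s≤s z≤n)))

prime⇒deg≥1 : ∀ {p} → Prime p → 1 ≤ deg p
prime⇒deg≥1 {p} (p≢0 , p≢1 , _) = ℕ.n≢0⇒n>0 λ d → p≢1 (deg≡0⇒≡1 p≢0 d)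

opaque
  valuation : ∀ {p} → Prime p → ∀ f → f ≢ 0# → ∃ λ k → ∃ λ g → f ≡ p ^ k * g × ¬ p ∣ᶠ g
  valuation {p} pr f f≢0 = go f f≢0 (<-wellFounded (deg f))
    where
    go : ∀ f → f ≢ 0# → Acc _<_ (deg f) → ∃ λ k → ∃ λ g → f ≡ p ^ k * g × ¬ p ∣ᶠ g
    go f f≢0 (acc rec) with p ∣? f
    ... | no p∤f = 0 , f , sym (*-identityˡ f) , p∤f
    ... | yes (h , refl) with go h h≢0 (rec lt)
      where
      h≢0 : h ≢ 0#
      h≢0 refl = f≢0 (*-zeroˡ p)
      lt : deg h < deg (h * p)
      lt = subst (deg h <_) (sym (deg-* h≢0 (proj₁ pr))) (ℕ.m<m+n (deg h) (prime⇒deg≥1 pr))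
    ...   | k , g , e , p∤g = suc k , g ,
            trans (cong (_* p) e) (solve 3 (λ t g p → t :* g :* p := p :* t :* g) refl (p ^ k) g p) , p∤g

opaque
  valuation-unique : ∀ {p} → Prime p → ∀ m n {f g} → ¬ p ∣ᶠ f → ¬ p ∣ᶠ g → p ^ m * f ≡ p ^ n * g → m ≡ n
  valuation-unique pr zero zero p∤f p∤g e = refl
  valuation-unique {p} pr zero (suc n) {f} {g} p∤f p∤g e = ⊥-elim (p∤f (p ^ n * g ,
    trans (sym (*-identityˡ f)) (trans e (solve 3 (λ t g p → p :* t :* g := t :* g :* p) refl (p ^ n) g p))))
  valuation-unique {p} pr (suc m) zero {f} {g} p∤f p∤g e = ⊥-elim (p∤g (p ^ m * f ,
    trans (sym (*-identityˡ g)) (trans (sym e) (solve 3 (λ t g p → p :* t :* g := t :* g :* p) refl (p ^ m) f p))))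
  valuation-unique {p} pr (suc m) (suc n) {f} {g} p∤f p∤g e =
    cong suc (valuation-unique pr m n p∤f p∤g (*-cancelˡ p (proj₁ pr)
      (trans (sym (*-assoc p (p ^ m) f)) (trans e (*-assoc p (p ^ n) g)))))

-- Sums of divisors

double : Poly → List Poly
double l = (false ∷ l) ∷ (true ∷ l) ∷ []

∈-double⁻ : ∀ ls {b l} → b ∷ l ∈ concatMap double ls → l ∈ ls
∈-double⁻ (_ ∷ _) (here refl) = here refl
∈-double⁻ (_ ∷ _) (there (here refl)) = here refl
∈-double⁻ (_ ∷ ls) (there (there m)) = there (∈-double⁻ ls m)

∈-double⁺ : ∀ ls {b l} → l ∈ ls → b ∷ l ∈ concatMap double ls
∈-double⁺ (_ ∷ _) {false} (here refl) = here refl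
∈-double⁺ (_ ∷ _) {true} (here refl) = there (here refl)
∈-double⁺ (_ ∷ ls) (there m) = there (there (∈-double⁺ ls m))

[]∉-double : ∀ ls → ¬ [] ∈ concatMap double ls
[]∉-double (_ ∷ ls) (there (there m)) = []∉-double ls m

double-unique : ∀ {ls} → Unique ls → Unique (concatMap double ls)
double-unique [] = []
double-unique {l ∷ ls} (l∉ ∷ u) = ((λ ()) ∷ fresh) ∷ fresh ∷ double-unique u
  where
  fresh : ∀ {b} → All (λ p → b ∷ l ≢ p) (concatMap double ls)
  fresh = All.tabulate λ { m refl → All.lookup l∉ (∈-double⁻ ls m) refl }

allLists-unique : ∀ n → Unique (allLists n)
allLists-unique zero = [] ∷ []
allLists-unique (suc n) = double-unique (allLists-unique n)

∈-allLists⁺ : ∀ l → l ∈ allLists (length l)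
∈-allLists⁺ [] = here refl
∈-allLists⁺ (b ∷ l) = ∈-double⁺ (allLists (length l)) (∈-allLists⁺ l)

∈-allLists⁻ : ∀ n l → l ∈ allLists n → length l ≡ n
∈-allLists⁻ zero l (here refl) = refl
∈-allLists⁻ (suc n) [] m = ⊥-elim ([]∉-double (allLists n) m)
∈-allLists⁻ (suc n) (b ∷ l) m = cong suc (∈-allLists⁻ n l (∈-double⁻ (allLists n) m))

pad : ∀ p n → length p ≤ n → ∃ λ l → length l ≡ n × l ≈ p
pad [] zero _ = [] , refl , refl
pad [] (suc n) _ with pad [] n z≤n
... | l , len , e = false ∷ l , cong suc len , cong (consN false) e
pad (b ∷ p) (suc n) (s≤s le) with pad p n le
... | l , len , e = b ∷ l , cong suc len , cong (consN b) e

∈-allLists-[] : ∀ {n} f → length (poly f) ≤ n → ∃ λ l → l ∈ allLists n × [ l ] ≡ f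
∈-allLists-[] {n} f le with pad (poly f) n le
... | l , refl , e = l , ∈-allLists⁺ l , trans ([]-cong l (poly f) e) ([poly] f)

≈∧length⇒≡ : ∀ p q → length p ≡ length q → p ≈ q → p ≡ q
≈∧length⇒≡ p q len e = go p q len (≈⇒≗ p q e)
  where
  go : ∀ p q → length p ≡ length q → coef p ≗ᶜ coef q → p ≡ q
  go [] [] _ _ = refl
  go (a ∷ p) (b ∷ q) len e = cong₂ _∷_ (e 0) (go p q (ℕ.suc-injective len) (λ i → e (suc i)))

[]-injective-allLists : ∀ n {p q} → p ∈ allLists n → q ∈ allLists n → [ p ] ≡ [ q ] → p ≡ q
[]-injective-allLists n {p} {q} mp mq e =
  ≈∧length⇒≡ p q (trans (∈-allLists⁻ n p mp) (sym (∈-allLists⁻ n q mq))) ([]-injective p q e)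

eqList-refl : ∀ p → eqList p p ≡ true
eqList-refl [] = refl
eqList-refl (true ∷ p) = eqList-refl p
eqList-refl (false ∷ p) = eqList-refl p

eqList-sound : ∀ p q → eqList p q ≡ true → p ≡ q
eqList-sound [] [] _ = refl
eqList-sound (true ∷ p) (true ∷ q) e = cong (true ∷_) (eqList-sound p q e)
eqList-sound (false ∷ p) (false ∷ q) e = cong (false ∷_) (eqList-sound p q e)

length-poly : ∀ {f} → f ≢ 0# → length (poly f) ≡ suc (deg f)
length-poly {mk [] _} f≢0 = ⊥-elim (f≢0 refl)
length-poly {mk (_ ∷ _) _} f≢0 = refl

∣⇒length≤ : ∀ {d f} → f ≢ 0# → d ∣ᶠ f → length (poly d) ≤ length (poly f)
∣⇒length≤ f≢0 d∣f = subst₂ _≤_ (sym (length-poly (∣⇒≢0 f≢0 d∣f))) (sym (length-poly f≢0)) (s≤s (∣⇒deg≤ f≢0 d∣f))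

module _ {A B : Set} (T : A → Bool) (d : B) where

  select : List A → List B
  select = concatMap (λ q → if T q then d ∷ [] else [])

  select-none : ∀ {qs} → (∀ {q} → q ∈ qs → T q ≢ true) → select qs ≡ []
  select-none {[]} none = refl
  select-none {q ∷ qs} none with T q in e
  ... | true = ⊥-elim (none (here refl) e)
  ... | false = select-none (λ m → none (there m))

  select-one : ∀ {qs q} → Unique qs → q ∈ qs → T q ≡ true →
               (∀ {q′} → q′ ∈ qs → T q′ ≡ true → q′ ≡ q) → select qs ≡ d ∷ []
  select-one {q ∷ qs} (q∉ ∷ u) (here refl) Tq only rewrite Tq =
    cong (d ∷_) (select-none λ m e → All.lookup q∉ m (sym (only (there m) e)))
  select-one {q ∷ qs} (q∉ ∷ u) (there m) Tq only with T q in e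
  ... | true = ⊥-elim (All.lookup q∉ m (only (here refl) e))
  ... | false = select-one u m Tq (λ m′ → only (there m′))

concatMap≡filter : ∀ {A : Set} {P : A → Set} (P? : ∀ a → Dec (P a)) (D : A → List A) ls →
  (∀ {a} → a ∈ ls → P a → D a ≡ a ∷ []) → (∀ {a} → a ∈ ls → ¬ P a → D a ≡ []) →
  concatMap D ls ≡ filter P? ls
concatMap≡filter P? D [] pos neg = refl
concatMap≡filter P? D (a ∷ ls) pos neg with P? a
... | yes p rewrite pos (here refl) p = cong (a ∷_) (concatMap≡filter P? D ls (λ m → pos (there m)) (λ m → neg (there m)))
... | no ¬p rewrite neg (here refl) ¬p = concatMap≡filter P? D ls (λ m → pos (there m)) (λ m → neg (there m))

rawDivisors : 𝔽₂[x] → List Poly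
rawDivisors f = filter (λ d → [ d ] ∣? f) (allLists (length (poly f)))

divisors : 𝔽₂[x] → List 𝔽₂[x]
divisors f = map [_] (rawDivisors f)

sum : List 𝔽₂[x] → 𝔽₂[x]
sum = foldr _+_ 0#

sigma : 𝔽₂[x] → 𝔽₂[x]
sigma f = sum (divisors f)

[sumP] : ∀ ls → [ sumP ls ] ≡ sum (map [_] ls)
[sumP] [] = refl
[sumP] (l ∷ ls) = trans ([+ₚ] l (sumP ls)) (cong ([ l ] +_) ([sumP] ls))

opaque
  -- The inner loop over cofactors emits `d` exactly once when `d` divides `a`: cancelling `d`
  -- leaves one cofactor, and lists of a fixed length represent a polynomial only once. Otherwise it
  -- emits nothing, so the double loop is a filter.
  [σ] : ∀ a → [ a ] ≢ 0# → [ σ a ] ≡ sigma [ a ]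
  [σ] a a≢0 = trans ([sumP] (concatMap D L)) (cong (λ ls → sum (map [_] ls)) (concatMap≡filter (λ d → [ d ] ∣? [ a ]) D L pos neg))
    where
    L : List Poly
    L = allLists (length (norm a))
    T : Poly → Poly → Bool
    T d q = eqList (d *ₚ q) (norm a)
    D : Poly → List Poly
    D d = select (T d) d L
    sound : ∀ d q → T d q ≡ true → [ a ] ≡ [ d ] * [ q ]
    sound d q e = trans (poly-injective (sym (trans (norm-idem (mulRaw d q)) (eqList-sound (d *ₚ q) (norm a) e)))) ([*ₚ] d q)
    complete : ∀ d q → [ a ] ≡ [ q ] * [ d ] → T d q ≡ true
    complete d q e = subst (λ t → eqList (d *ₚ q) t ≡ true)
      (trans (sym (norm-idem (mulRaw d q))) (cong poly (trans ([*ₚ] d q) (trans (*-comm [ d ] [ q ]) (sym e)))))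
      (eqList-refl (d *ₚ q))
    pos : ∀ {d} → d ∈ L → [ d ] ∣ᶠ [ a ] → D d ≡ d ∷ []
    pos {d} md (q , e) with ∈-allLists-[] q (∣⇒length≤ a≢0 ([ d ] , trans e (*-comm q [ d ])))
    ... | l , ml , refl = select-one (T d) d (allLists-unique (length (norm a))) ml (complete d l e)
      λ {q′} m′ e′ → []-injective-allLists (length (norm a)) m′ ml (*-cancelˡ [ d ] (∣⇒≢0 a≢0 ([ l ] , e))
        (trans (sym (sound d q′ e′)) (trans e (*-comm [ l ] [ d ]))))
    neg : ∀ {d} → d ∈ L → ¬ [ d ] ∣ᶠ [ a ] → D d ≡ []
    neg {d} md ∤ = select-none (T d) d {L} λ {q} m e → ∤ ([ q ] , trans (sound d q e) (*-comm [ d ] [ q ]))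

divisors-sound : ∀ f {d} → d ∈ divisors f → d ∣ᶠ f
divisors-sound f m with ∈-map⁻ [_] m
... | l , m′ , refl = proj₂ (∈-filter⁻ (λ d → [ d ] ∣? f) {xs = allLists (length (poly f))} m′)

divisors-complete : ∀ {f d} → f ≢ 0# → d ∣ᶠ f → d ∈ divisors f
divisors-complete {f} {d} f≢0 d∣f with ∈-allLists-[] d (∣⇒length≤ f≢0 d∣f)
... | l , m , refl = ∈-map⁺ [_] (∈-filter⁺ (λ d → [ d ] ∣? f) m d∣f)

map-unique : ∀ {A B : Set} (g : A → B) {as} → (∀ {a b} → a ∈ as → b ∈ as → g a ≡ g b → a ≡ b) →
             Unique as → Unique (map g as)
map-unique g inj [] = []
map-unique g inj (a∉ ∷ u) =
  All.map⁺ (All.tabulate λ m e → All.lookup a∉ m (inj (here refl) (there m) e)) ∷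
  map-unique g (λ m m′ → inj (there m) (there m′)) u

divisors-unique : ∀ f → Unique (divisors f)
divisors-unique f = map-unique [_] (λ m m′ → []-injective-allLists (length (poly f)) (inAll m) (inAll m′))
  (Unique.filter⁺ (λ d → [ d ] ∣? f) (allLists-unique (length (poly f))))
  where
  inAll : ∀ {l} → l ∈ rawDivisors f → l ∈ allLists (length (poly f))
  inAll m = proj₁ (∈-filter⁻ (λ d → [ d ] ∣? f) {xs = allLists (length (poly f))} m)

sum-↭ : ∀ {fs gs} → fs ↭ gs → sum fs ≡ sum gs
sum-↭ π = PermSetoid.foldr-commMonoid (setoid 𝔽₂[x]) +-isCommutativeMonoid (↭⇒↭ₛ π)

sum-++ : ∀ fs gs → sum (fs ++ gs) ≡ sum fs + sum gs
sum-++ [] gs = sym (+-identityˡ (sum gs))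
sum-++ (f ∷ fs) gs = trans (cong (f +_) (sum-++ fs gs)) (sym (+-assoc f (sum fs) (sum gs)))

sum-map-* : ∀ p fs → sum (map (p *_) fs) ≡ p * sum fs
sum-map-* p [] = sym (zeroʳ p)
sum-map-* p (f ∷ fs) = trans (cong (p * f +_) (sum-map-* p fs)) (sym (*-distribˡ-+ p f (sum fs)))

coprime-divides-^ : ∀ {d p f} n → Coprime d p → d ∣ᶠ p ^ n * f → d ∣ᶠ f
coprime-divides-^ {d} {f = f} zero c h = subst (d ∣ᶠ_) (*-identityˡ f) h
coprime-divides-^ {d} {p} {f} (suc n) c h =
  coprime-divides-^ n c (coprime-divides c (subst (d ∣ᶠ_) (*-assoc p (p ^ n) f) h))

^-≢0 : ∀ {f} → f ≢ 0# → ∀ n → f ^ n ≢ 0#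
^-≢0 f≢0 zero = 1≢0
^-≢0 f≢0 (suc n) = *-≢0 f≢0 (^-≢0 f≢0 n)

∤⇒≢0 : ∀ {p f} → ¬ p ∣ᶠ f → f ≢ 0#
∤⇒≢0 p∤f refl = p∤f ∣0

-- A divisor of pⁿ⁺¹f is either p times a divisor of pⁿf, or prime to p and hence a divisor of f.
divisors-step : ∀ {p} → Prime p → ∀ n {f} → ¬ p ∣ᶠ f →
  divisors (p ^ suc n * f) ↭ map (p *_) (divisors (p ^ n * f)) ++ divisors f
divisors-step {p} pr n {f} p∤f = ∼bag⇒↭ (unique∧set⇒bag (divisors-unique (p ^ suc n * f))
  (Unique.++⁺ (Unique.map⁺ (*-cancelˡ p (proj₁ pr)) (divisors-unique (p ^ n * f))) (divisors-unique f) disjoint)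
  (mk⇔ to from))
  where
  f≢0 : f ≢ 0#
  f≢0 = ∤⇒≢0 p∤f
  p^n≢0 : p ^ n * f ≢ 0#
  p^n≢0 = *-≢0 (^-≢0 (proj₁ pr) n) f≢0
  p^sn≢0 : p ^ suc n * f ≢ 0#
  p^sn≢0 = *-≢0 (^-≢0 (proj₁ pr) (suc n)) f≢0
  disjoint : ∀ {d} → ¬ (d ∈ map (p *_) (divisors (p ^ n * f)) × d ∈ divisors f)
  disjoint (m , m′) with ∈-map⁻ (p *_) m
  ... | e , _ , refl = p∤f (∣-trans (m∣m*n e) (divisors-sound f m′))
  to : ∀ {d} → d ∈ divisors (p ^ suc n * f) → d ∈ map (p *_) (divisors (p ^ n * f)) ++ divisors f
  to {d} m with divisors-sound (p ^ suc n * f) m | p ∣? d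
  ... | d∣ | no p∤d = ∈-++⁺ʳ _ (divisors-complete f≢0 (coprime-divides-^ (suc n) (∤⇒coprime pr p∤d) d∣))
  ... | q , e | yes (d′ , refl) = ∈-++⁺ˡ (subst (_∈ map (p *_) (divisors (p ^ n * f))) (*-comm p d′)
    (∈-map⁺ (p *_) (divisors-complete p^n≢0 (q , *-cancelˡ p (proj₁ pr)
      (trans (sym (*-assoc p (p ^ n) f)) (trans e
        (solve 3 (λ q d p → q :* (d :* p) := p :* (q :* d)) refl q d′ p)))))))
  from : ∀ {d} → d ∈ map (p *_) (divisors (p ^ n * f)) ++ divisors f → d ∈ divisors (p ^ suc n * f)
  from {d} m with ∈-++⁻ (map (p *_) (divisors (p ^ n * f))) m
  ... | inj₂ m′ = divisors-complete p^sn≢0 (∣-* (p ^ suc n) (divisors-sound f m′))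
  ... | inj₁ m′ with ∈-map⁻ (p *_) m′
  ...   | e , me , refl with divisors-sound (p ^ n * f) me
  ...     | q , eq = divisors-complete p^sn≢0 (q , trans (*-assoc p (p ^ n) f) (trans (cong (p *_) eq)
                       (solve 3 (λ p q e → p :* (q :* e) := q :* (p :* e)) refl p q e)))

-- The sum s(p, n) in Horner form, so that its low-order part 1 + p (1 + p g) appears by mere
-- unfolding.
geom : 𝔽₂[x] → ℕ → 𝔽₂[x]
geom p zero = 1#
geom p (suc n) = 1# + p * geom p n

opaque
  -- `divisors-step` yields σ(pⁿ⁺¹f) = p σ(pⁿf) + σ(f), which is the recursion of `geom` multiplied
  -- by σ(f).
  sigma-prime-power : ∀ {p} → Prime p → ∀ n {f} → ¬ p ∣ᶠ f → sigma (p ^ n * f) ≡ geom p n * sigma f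
  sigma-prime-power pr zero {f} p∤f = trans (cong sigma (*-identityˡ f)) (sym (*-identityˡ (sigma f)))
  sigma-prime-power {p} pr (suc n) {f} p∤f = begin
    sigma (p ^ suc n * f)
      ≡⟨ sum-↭ (divisors-step pr n p∤f) ⟩
    sum (map (p *_) (divisors (p ^ n * f)) ++ divisors f)
      ≡⟨ sum-++ (map (p *_) (divisors (p ^ n * f))) (divisors f) ⟩
    sum (map (p *_) (divisors (p ^ n * f))) + sigma f
      ≡⟨ cong (_+ sigma f) (sum-map-* p (divisors (p ^ n * f))) ⟩
    p * sigma (p ^ n * f) + sigma f
      ≡⟨ cong (λ t → p * t + sigma f) (sigma-prime-power pr n p∤f) ⟩
    p * (geom p n * sigma f) + sigma f
      ≡⟨ solve 3 (λ p g s → p :* (g :* s) :+ s := (con true :+ p :* g) :* s) refl p (geom p n) (sigma f) ⟩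
    geom p (suc n) * sigma f ∎
    where open ≡-Reasoning

sigma-1 : sigma 1# ≡ 1#
sigma-1 = sym ([σ] oneP 1≢0)

opaque
  -- The finite list of divisors is searched for one other than 1 and `f`. Such a divisor has
  -- smaller degree and is pursued further; if there is none, `f` itself is prime.
  prime-factor : ∀ f → f ≢ 0# → f ≢ 1# → ∃ λ p → Prime p × p ∣ᶠ f
  prime-factor f f≢0 f≢1 = go f f≢0 f≢1 (<-wellFounded (deg f))
    where
    go : ∀ f → f ≢ 0# → f ≢ 1# → Acc _<_ (deg f) → ∃ λ p → Prime p × p ∣ᶠ f
    go f f≢0 f≢1 (acc rec) with any? (λ d → ¬? (d ≟ 1#) ×-dec ¬? (d ≟ f)) (divisors f)
    ... | yes proper with find proper
    ...   | d , m , d≢1 , d≢f with divisors-sound f m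
    ...     | d∣f with go d (∣⇒≢0 f≢0 d∣f) d≢1 (rec (ℕ.≰⇒> λ le → d≢f (∣∧deg≤⇒≡ f≢0 d∣f le)))
    ...       | p , pr , p∣d = p , pr , ∣-trans p∣d d∣f
    go f f≢0 f≢1 (acc rec) | no none = f , (f≢0 , f≢1 , irr) , ∣-refl
      where
      irr : ∀ d → d ∣ᶠ f → d ≡ 1# ⊎ d ≡ f
      irr d d∣f with d ≟ 1# | d ≟ f
      ... | yes e | _ = inj₁ e
      ... | _ | yes e = inj₂ e
      ... | no d≢1 | no d≢f = ⊥-elim (none (lose (divisors-complete f≢0 d∣f) (d≢1 , d≢f)))

-- Products of primes and geometric sums

∏ : List 𝔽₂[x] → 𝔽₂[x]
∏ = foldr _*_ 1#

∏-↭ : ∀ {fs gs} → fs ↭ gs → ∏ fs ≡ ∏ gs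
∏-↭ π = PermSetoid.foldr-commMonoid (setoid 𝔽₂[x]) *-isCommutativeMonoid (↭⇒↭ₛ π)

-- For distinct primes this is σ of their product.
∏⁺ : List 𝔽₂[x] → 𝔽₂[x]
∏⁺ fs = ∏ (map (1# +_) fs)

∏⁺-↭ : ∀ {fs gs} → fs ↭ gs → ∏⁺ fs ≡ ∏⁺ gs
∏⁺-↭ π = ∏-↭ (map⁺ (1# +_) π)

opaque
  *-extractˡ : ∀ p f g → p * (f * g) ≡ f * p * g
  *-extractˡ = solve 3 (λ p f g → p :* (f :* g) := f :* p :* g) refl

opaque
  *-extractʳ : ∀ p f g → p * (f * g) ≡ f * (g * p)
  *-extractʳ = solve 3 (λ p f g → p :* (f :* g) := f :* (g :* p)) refl

opaque
  -- Unique factorisation in the form needed: each prime of the list divides one of the two factors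
  -- and is cancelled there. What remains multiplies to 1, and 1 is the only unit.
  ∏-split : ∀ {ps} → All Prime ps → ∀ {f g} → f * g ≡ ∏ ps →
            ∃ λ ls → ∃ λ ms → ps ↭ ls ++ ms × f ≡ ∏ ls × g ≡ ∏ ms
  ∏-split [] {f} {g} e = [] , [] , ↭-refl , *≡1⇒≡1 (trans (*-comm g f) e) , *≡1⇒≡1 e
  ∏-split {p ∷ ps} (pr ∷ prs) {f} {g} e with euclid {p} {f} {g} pr (∏ ps , trans e (*-comm p (∏ ps)))
  ... | inj₁ (f′ , refl) with ∏-split prs {f′} {g} (*-cancelˡ p (proj₁ pr) (trans (*-extractˡ p f′ g) e))
  ...   | ls , ms , π , ef , eg = p ∷ ls , ms , ↭-prep p π , trans (*-comm f′ p) (cong (p *_) ef) , eg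
  ∏-split {p ∷ ps} (pr ∷ prs) {f} {g} e | inj₂ (g′ , refl)
    with ∏-split prs {f} {g′} (*-cancelˡ p (proj₁ pr) (trans (*-extractʳ p f g′) e))
  ...   | ls , ms , π , ef , eg =
          ls , p ∷ ms , ↭-trans (↭-prep p π) (↭-sym (shift p ls ms)) , ef , trans (*-comm g′ p) (cong (p *_) eg)

odd≢even : ∀ m n → suc (m ℕ.+ m) ≢ n ℕ.+ n
odd≢even zero (suc (suc n)) ()
odd≢even zero (suc zero) ()
odd≢even (suc m) (suc n) e = odd≢even m n (ℕ.suc-injective (ℕ.suc-injective
  (trans (cong (λ t → suc (suc t)) (sym (ℕ.+-suc m m))) (trans e (cong suc (ℕ.+-suc n n))))))

opaque
  ^-square : ∀ f n → f ^ (n ℕ.+ n) ≡ f ^ n * f ^ n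
  ^-square f n = ^-homo-* f n n

opaque
  *^-square : ∀ p k g → (p ^ k * g) * (p ^ k * g) ≡ p ^ (k ℕ.+ k) * (g * g)
  *^-square p k g = trans (solve 2 (λ t g → t :* g :* (t :* g) := t :* t :* (g :* g)) refl (p ^ k) g)
    (cong (_* (g * g)) (sym (^-square p k)))

∤-1+ : ∀ {p f} → Prime p → p ∣ᶠ f → ¬ p ∣ᶠ 1# + f
∤-1+ {p} {f} pr p∣f p∣1+f = prime∤1 pr (subst (p ∣ᶠ_)
  (solve 1 (λ f → con true :+ f :+ f := con true) refl f) (∣-+ p∣1+f p∣f))

∤-* : ∀ {p f g} → Prime p → ¬ p ∣ᶠ f → ¬ p ∣ᶠ g → ¬ p ∣ᶠ f * g
∤-* pr p∤f p∤g d with euclid pr d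
... | inj₁ h = p∤f h
... | inj₂ h = p∤g h

1+≢0 : ∀ {f} → f ≢ 1# → 1# + f ≢ 0#
1+≢0 f≢1 e = f≢1 (sym (+≡0⇒≡ e))

-- The exponent of q is odd on the left and even on the right.
opaque
  square*q[1+q]≢square : ∀ {q} → Prime q → ∀ {s t} → s ≢ 0# → s * s * (q * (1# + q)) ≢ t * t
  square*q[1+q]≢square {q} pr@(q≢0 , q≢1 , _) {s} {t} s≢0 e
    with valuation pr s s≢0
  ... | k , s′ , refl , q∤s′ with valuation pr t t≢0
    where
    t≢0 : t ≢ 0#
    t≢0 refl = *-≢0 (*-≢0 s≢0 s≢0) (*-≢0 q≢0 (1+≢0 q≢1)) (trans e (zeroʳ 0#))
  ... | l , t′ , refl , q∤t′ = odd≢even k l (valuation-unique pr (suc (k ℕ.+ k)) (l ℕ.+ l)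
        {s′ * s′ * (1# + q)} {t′ * t′}
        (∤-* pr (∤-* pr q∤s′ q∤s′) (∤-1+ pr ∣-refl)) (∤-* pr q∤t′ q∤t′) (begin
    q * q ^ (k ℕ.+ k) * (s′ * s′ * (1# + q))
      ≡⟨ solve 3 (λ q t s → q :* t :* (s :* s :* (con true :+ q)) := t :* (s :* s) :* (q :* (con true :+ q)))
           refl q (q ^ (k ℕ.+ k)) s′ ⟩
    q ^ (k ℕ.+ k) * (s′ * s′) * (q * (1# + q))
      ≡⟨ cong (_* (q * (1# + q))) (*^-square q k s′) ⟨
    q ^ k * s′ * (q ^ k * s′) * (q * (1# + q))
      ≡⟨ e ⟩
    q ^ l * t′ * (q ^ l * t′)
      ≡⟨ *^-square q l t′ ⟩
    q ^ (l ℕ.+ l) * (t′ * t′) ∎))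
    where open ≡-Reasoning

opaque
  geom-telescope : ∀ p n → (1# + p) * geom p n ≡ 1# + p ^ suc n
  geom-telescope p zero = solve 1 (λ p → (con true :+ p) :* con true := con true :+ p :* con true) refl p
  geom-telescope p (suc n) = begin
    (1# + p) * (1# + p * geom p n)
      ≡⟨ solve 2 (λ p g → (con true :+ p) :* (con true :+ p :* g) := con true :+ p :+ p :* ((con true :+ p) :* g)) refl p (geom p n) ⟩
    1# + p + p * ((1# + p) * geom p n)
      ≡⟨ cong (λ t → 1# + p + p * t) (geom-telescope p n) ⟩
    1# + p + p * (1# + p ^ suc n)
      ≡⟨ solve 2 (λ p t → con true :+ p :+ p :* (con true :+ t) := con true :+ p :* t) refl p (p ^ suc n) ⟩
    1# + p ^ suc (suc n) ∎
    where open ≡-Reasoning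

opaque
  -- Telescoping turns the left side into p + p²ᵃ⁺¹, and 1 + p²ᵃ is a square in characteristic 2.
  geom-even : ∀ p a → (1# + p) * (1# + geom p (a ℕ.+ a)) ≡ p * ((1# + p ^ a) * (1# + p ^ a))
  geom-even p a = begin
    (1# + p) * (1# + geom p (a ℕ.+ a))
      ≡⟨ solve 2 (λ p g → (con true :+ p) :* (con true :+ g) := con true :+ p :+ (con true :+ p) :* g) refl p (geom p (a ℕ.+ a)) ⟩
    1# + p + (1# + p) * geom p (a ℕ.+ a)
      ≡⟨ cong (1# + p +_) (geom-telescope p (a ℕ.+ a)) ⟩
    1# + p + (1# + p * p ^ (a ℕ.+ a))
      ≡⟨ cong (λ t → 1# + p + (1# + p * t)) (^-square p a) ⟩
    1# + p + (1# + p * (p ^ a * p ^ a))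
      ≡⟨ solve 2 (λ p t → con true :+ p :+ (con true :+ p :* (t :* t)) := p :* ((con true :+ t) :* (con true :+ t))) refl p (p ^ a) ⟩
    p * ((1# + p ^ a) * (1# + p ^ a)) ∎
    where open ≡-Reasoning

1+p*≢0 : ∀ {p} → Prime p → ∀ f → 1# + p * f ≢ 0#
1+p*≢0 {p} pr f e = ∤-1+ pr (m∣m*n f) (subst (p ∣ᶠ_) (sym e) ∣0)

geom-≢0 : ∀ {p} → Prime p → ∀ n → geom p n ≢ 0#
geom-≢0 pr zero = 1≢0
geom-≢0 pr (suc n) = 1+p*≢0 pr _

opaque
  geom-≢1 : ∀ {p} → Prime p → ∀ n → geom p (suc n) ≢ 1#
  geom-≢1 {p} pr n e = *-≢0 (proj₁ pr) (geom-≢0 pr n)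
    (trans (solve 1 (λ t → t := con true :+ (con true :+ t)) refl (p * geom p n)) (trans (cong (1# +_) e) (+-self 1#)))

HasDeg-+ : ∀ {f g m n} → HasDeg f m → HasDeg g n → n < m → HasDeg (f + g) m
HasDeg-+ {f} {g} {m} (tf , af) (tg , ag) n<m =
  trans (coef-+ f g m) (cong₂ _xor_ tf (ag m n<m)) ,
  λ i m<i → trans (coef-+ f g i) (cong₂ _xor_ (af i m<i) (ag i (ℕ.<-trans n<m m<i)))

HasDeg-1# : HasDeg 1# 0
HasDeg-1# = refl , λ { (suc i) _ → refl }

HasDeg-1+ : ∀ {f n} → HasDeg f (suc n) → HasDeg (1# + f) (suc n)
HasDeg-1+ {f} {n} d = subst (λ t → HasDeg t (suc n)) (+-comm f 1#) (HasDeg-+ {f} {1#} d HasDeg-1# (s≤s z≤n))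

HasDeg-geom : ∀ {y} → HasDeg y 1 → ∀ n → HasDeg (geom y n) n
HasDeg-geom d zero = HasDeg-1#
HasDeg-geom {y} d (suc n) = HasDeg-1+ {y * geom y n} (HasDeg-* {y} {geom y n} d (HasDeg-geom {y} d n))

opaque
  1+p*-power : ∀ p m → ∃ λ t → (1# + p) ^ m ≡ 1# + p * t
  1+p*-power p zero = 0# , solve 1 (λ p → con true := con true :+ p :* con false) refl p
  1+p*-power p (suc m) with 1+p*-power p m
  ... | t , e = 1# + (1# + p) * t , trans (cong ((1# + p) *_) e)
    (solve 2 (λ p t → (con true :+ p) :* (con true :+ p :* t) := con true :+ p :* (con true :+ (con true :+ p) :* t)) refl p t)

-- Exponents n with (1 + y)ⁿ = 1 + yⁿ

pow2 : ℕ → ℕ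
pow2 zero = 1
pow2 (suc k) = pow2 k ℕ.+ pow2 k

halve : ∀ n → ∃ λ m → n ≡ m ℕ.+ m ⊎ n ≡ suc (m ℕ.+ m)
halve zero = 0 , inj₁ refl
halve (suc n) with halve n
... | m , inj₁ refl = m , inj₂ refl
... | m , inj₂ refl = suc m , inj₁ (cong suc (sym (ℕ.+-suc m m)))

opaque
  freshman-half : ∀ y m → (1# + y) ^ (m ℕ.+ m) ≡ 1# + y ^ (m ℕ.+ m) → (1# + y) ^ m ≡ 1# + y ^ m
  freshman-half y m e = square-injective (begin
    (1# + y) ^ m * (1# + y) ^ m   ≡⟨ ^-square (1# + y) m ⟨
    (1# + y) ^ (m ℕ.+ m)          ≡⟨ e ⟩
    1# + y ^ (m ℕ.+ m)            ≡⟨ cong (1# +_) (^-square y m) ⟩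
    1# + y ^ m * y ^ m            ≡⟨ solve 1 (λ t → con true :+ t :* t := (con true :+ t) :* (con true :+ t)) refl (y ^ m) ⟩
    (1# + y ^ m) * (1# + y ^ m)   ∎)
    where open ≡-Reasoning

-- Modulo y², the odd power (1 + y)ⁿ is 1 + y, while 1 + yⁿ is 1 unless n = 1.
opaque
  freshman-odd : ∀ {y} → Prime y → ∀ m → let n = suc (suc m ℕ.+ suc m) in (1# + y) ^ n ≢ 1# + y ^ n
  freshman-odd {y} pr m e with 1+p*-power y (suc m)
  ... | t , et = *-≢0 (proj₁ pr) (1+p*≢0 pr ((1# + y) * t * t + y * (y ^ m * y ^ m))) (begin
    y * (1# + y * ((1# + y) * t * t + y * (y ^ m * y ^ m)))
      ≡⟨ solve 3 (λ y t v → y :* (con true :+ y :* ((con true :+ y) :* t :* t :+ y :* (v :* v))) :=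
                    (con true :+ y) :* ((con true :+ y :* t) :* (con true :+ y :* t)) :+ (con true :+ y :* (y :* v :* (y :* v))))
           refl y t (y ^ m) ⟩
    (1# + y) * ((1# + y * t) * (1# + y * t)) + (1# + y * (y ^ suc m * y ^ suc m))
      ≡⟨ cong₂ (λ u v → (1# + y) * u + (1# + y * v)) (trans (^-square (1# + y) (suc m)) (cong₂ _*_ et et)) (^-square y (suc m)) ⟨
    (1# + y) ^ suc (suc m ℕ.+ suc m) + (1# + y ^ suc (suc m ℕ.+ suc m))
      ≡⟨ cong (_+ (1# + y ^ suc (suc m ℕ.+ suc m))) e ⟩
    (1# + y ^ suc (suc m ℕ.+ suc m)) + (1# + y ^ suc (suc m ℕ.+ suc m))
      ≡⟨ +-self _ ⟩
    0# ∎)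
    where open ≡-Reasoning

opaque
  -- Descent on the exponent: an even one is halved by taking square roots, which are unique in
  -- 𝔽₂[x], and by `freshman-odd` the only odd one that can occur is 1.
  freshman⇒pow2 : ∀ {y} → Prime y → ∀ n → (1# + y) ^ suc n ≡ 1# + y ^ suc n → ∃ λ k → suc n ≡ pow2 k
  freshman⇒pow2 {y} pr n = go n (<-wellFounded n)
    where
    go : ∀ n → Acc _<_ n → (1# + y) ^ suc n ≡ 1# + y ^ suc n → ∃ λ k → suc n ≡ pow2 k
    go n (acc rec) e with halve (suc n)
    ... | zero , inj₂ refl = 0 , refl
    ... | suc m , inj₂ refl = ⊥-elim (freshman-odd pr m e)
    ... | suc m , inj₁ refl with go m (rec (ℕ.m≤n+m (suc m) m)) (freshman-half y (suc m) e)
    ...   | k , e′ = suc k , cong₂ ℕ._+_ e′ e′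

-- Irreducibility of 1 + y + ⋯ + y^2ᵏ

-- Repeated squaring makes the induction step of `trace-identity` a polynomial identity in y, h and
-- the previous trace, within reach of the solver.
frob : 𝔽₂[x] → ℕ → 𝔽₂[x]
frob y zero = y
frob y (suc k) = frob y k * frob y k

opaque
  frob≡^ : ∀ y k → frob y k ≡ y ^ pow2 k
  frob≡^ y zero = sym (*-identityʳ y)
  frob≡^ y (suc k) = trans (cong₂ _*_ (frob≡^ y k) (frob≡^ y k)) (sym (^-square y (pow2 k)))

-- With h = 2ᵏ this is yʰ Σ_{i ≤ k} (y^2ⁱ + y^-2ⁱ). When y²ʰ⁺¹ = 1 the sum is the trace
-- of y over the field with (2h)² elements, hence 0 or 1 modulo every prime factor of 1 + y²ʰ⁺¹.
trace : 𝔽₂[x] → ℕ → 𝔽₂[x]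
trace y zero = 1# + y * y
trace y (suc k) = (frob y k * frob y k) * (frob y k * frob y k) + (frob y k * trace y k + 1#)

opaque
  -- With h = 2ᵏ and trace = yʰ S, division by y²ʰ⁺¹ turns this into S² + S = y + y⁻¹ + y²ʰ + y⁻²ʰ,
  -- where the sum telescopes because squaring sends each term of S to the next. The induction stays
  -- with polynomials and avoids inverses.
  trace-identity : ∀ y k → y * (trace y k * (trace y k + frob y k)) ≡ (y + frob y k * frob y k) * (1# + y * (frob y k * frob y k))
  trace-identity y zero = solve 1 (λ y → y :* ((con true :+ y :* y) :* (con true :+ y :* y :+ y)) :=
    (y :+ y :* y) :* (con true :+ y :* (y :* y))) refl y
  trace-identity y (suc k) = begin
    y * (trace y (suc k) * (trace y (suc k) + h * h))
      ≡⟨ solve 3 (λ y h t → let t′ = h :* h :* (h :* h) :+ (h :* t :+ con true) in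
                   y :* (t′ :* (t′ :+ h :* h)) :=
                   y :* ((con true :+ h :^ 4) :* (con true :+ h :^ 4 :+ h :^ 2)) :+ h :* h :* (y :* (t :* (t :+ h))))
           refl y h (trace y k) ⟩
    y * ((1# + h ^ 4) * (1# + h ^ 4 + h ^ 2)) + h * h * (y * (trace y k * (trace y k + h)))
      ≡⟨ cong (λ u → y * ((1# + h ^ 4) * (1# + h ^ 4 + h ^ 2)) + h * h * u) (trace-identity y k) ⟩
    y * ((1# + h ^ 4) * (1# + h ^ 4 + h ^ 2)) + h * h * ((y + h * h) * (1# + y * (h * h)))
      ≡⟨ solve 2 (λ y h → y :* ((con true :+ h :^ 4) :* (con true :+ h :^ 4 :+ h :^ 2)) :+ h :* h :* ((y :+ h :* h) :* (con true :+ y :* (h :* h))) :=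
                   (y :+ h :* h :* (h :* h)) :* (con true :+ y :* (h :* h :* (h :* h))))
           refl y h ⟩
    (y + h * h * (h * h)) * (1# + y * (h * h * (h * h))) ∎
    where
    open ≡-Reasoning
    h : 𝔽₂[x]
    h = frob y k

pow2>0 : ∀ k → 0 < pow2 k
pow2>0 zero = s≤s z≤n
pow2>0 (suc k) = ℕ.≤-trans (pow2>0 k) (ℕ.m≤m+n (pow2 k) (pow2 k))

HasDeg-frob : ∀ {y} → HasDeg y 1 → ∀ k → HasDeg (frob y k) (pow2 k)
HasDeg-frob d zero = d
HasDeg-frob {y} d (suc k) = HasDeg-* {frob y k} {frob y k} (HasDeg-frob {y} d k) (HasDeg-frob {y} d k)

HasDeg-trace : ∀ {y} → HasDeg y 1 → ∀ k → HasDeg (trace y k) (pow2 (suc k))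
HasDeg-trace {y} d zero = HasDeg-1+ {y * y} (HasDeg-* {y} {y} d d)
HasDeg-trace {y} d (suc k) =
  HasDeg-+ {h * h * (h * h)} {h * trace y k + 1#} (HasDeg-* {h * h} {h * h} dhh dhh)
    (HasDeg-+ {h * trace y k} {1#} (HasDeg-* {h} {trace y k} dh (HasDeg-trace {y} d k)) HasDeg-1#
      (ℕ.<-≤-trans (pow2>0 k) (ℕ.m≤m+n (pow2 k) (pow2 (suc k)))))
    (ℕ.+-monoˡ-< (pow2 (suc k)) (ℕ.m<m+n (pow2 k) (pow2>0 k)))
  where
  h : 𝔽₂[x]
  h = frob y k
  dh : HasDeg h (pow2 k)
  dh = HasDeg-frob {y} d k
  dhh : HasDeg (h * h) (pow2 (suc k))
  dhh = HasDeg-* {h} {h} dh dh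

opaque
  y∣frob : ∀ y k → ∃ λ s → frob y k ≡ y * s
  y∣frob y zero = 1# , sym (*-identityʳ y)
  y∣frob y (suc k) with y∣frob y k
  ... | s , e = s * frob y k , trans (cong (_* frob y k) e) (*-assoc y s (frob y k))

opaque
  y²∣frob : ∀ y k → ∃ λ s → frob y (suc k) ≡ y * (y * s)
  y²∣frob y k with y∣frob y k
  ... | s , e = s * s , trans (cong₂ _*_ e e) (solve 2 (λ y s → y :* s :* (y :* s) := y :* (y :* (s :* s))) refl y s)

opaque
  -- Every term of the recursion except the final 1 contains `frob y (suc k)`, a multiple of y².
  -- Index 2 is the least possible: `trace y 1` begins with 1 + y.
  trace-mod : ∀ y k → ∃ λ t → trace y (suc (suc k)) ≡ 1# + y * (y * t)
  trace-mod y k = _ , trans (cong (λ f → f * f * (f * f) + (f * trace y (suc k) + 1#)) (proj₂ (y²∣frob y k)))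
    (solve 3 (λ y s g → let f = y :* (y :* s) in
       f :* f :* (f :* f) :+ (f :* g :+ con true) :=
       con true :+ y :* (y :* ((y :* s) :* (y :* s) :* (f :* f) :+ s :* g))) refl y (proj₁ (y²∣frob y k)) (trace y (suc k)))

opaque
  trace+frob-mod : ∀ y k → ∃ λ t → trace y (suc (suc k)) + frob y (suc (suc k)) ≡ 1# + y * (y * t)
  trace+frob-mod y k = _ , trans (cong₂ _+_ (proj₂ (trace-mod y k)) (proj₂ (y²∣frob y (suc k))))
    (solve 3 (λ y s t → con true :+ y :* (y :* t) :+ y :* (y :* s) := con true :+ y :* (y :* (t :+ s)))
      refl y (proj₁ (y²∣frob y (suc k))) (proj₁ (trace-mod y k)))

opaque
  1+y≢1-mod-y² : ∀ {y} → Prime y → ∀ g t → 1# + y * (1# + y * g) ≢ 1# + y * (y * t)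
  1+y≢1-mod-y² {y} pr g t e = *-≢0 (proj₁ pr) (1+p*≢0 pr (g + t)) (begin
    y * (1# + y * (g + t))
      ≡⟨ solve 3 (λ y g t → y :* (con true :+ y :* (g :+ t)) := con true :+ y :* (con true :+ y :* g) :+ (con true :+ y :* (y :* t))) refl y g t ⟩
    1# + y * (1# + y * g) + (1# + y * (y * t))
      ≡⟨ cong (_+ (1# + y * (y * t))) e ⟩
    1# + y * (y * t) + (1# + y * (y * t))
      ≡⟨ +-self _ ⟩
    0# ∎)
    where open ≡-Reasoning

opaque
  geom-mod : ∀ y n → 2 ≤ n → ∃ λ g → geom y n ≡ 1# + y * (1# + y * g)
  geom-mod y (suc (suc n)) _ = geom y n , refl
  geom-mod y (suc zero) (s≤s ())

2≤pow2 : ∀ k → 2 ≤ pow2 (suc k)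
2≤pow2 k = ℕ.+-mono-≤ (pow2>0 k) (pow2>0 k)

opaque
  geom∣trace : ∀ y k → geom y (pow2 (suc k)) ∣ᶠ y * (trace y k * (trace y k + frob y k))
  geom∣trace y k = subst (geom y (pow2 (suc k)) ∣ᶠ_) (sym (trace-identity y k))
    (∣-* (y + frob y k * frob y k) (1# + y , sym (trans (geom-telescope y (pow2 (suc k)))
      (cong (λ t → 1# + y * t) (sym (frob≡^ y (suc k)))))))

geom-∣⇒≡ : ∀ {y f} n → HasDeg y 1 → HasDeg f n → geom y n ∣ᶠ f → geom y n ≡ f
geom-∣⇒≡ {y} {f} n dy df h = ∣∧deg≤⇒≡ (HasDeg⇒≢0 {f} df) h
  (ℕ.≤-reflexive (trans (HasDeg⇒deg {f} df) (sym (HasDeg⇒deg {geom y n} (HasDeg-geom {y} dy n)))))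

geom∤y : ∀ {y n} → HasDeg y 1 → 2 ≤ n → ¬ geom y n ∣ᶠ y
geom∤y {y} {n} d le h = ℕ.<⇒≱ le (subst₂ _≤_ (HasDeg⇒deg {geom y n} (HasDeg-geom {y} d n))
  (HasDeg⇒deg {y} d) (∣⇒deg≤ (HasDeg⇒≢0 {y} d) h))

geom≢1-mod-y² : ∀ {y n} → Prime y → 2 ≤ n → ∀ {f} → (∃ λ t → f ≡ 1# + y * (y * t)) → geom y n ≢ f
geom≢1-mod-y² {y} {n} pr le (t , e) e′ with geom-mod y n le
... | g , eg = 1+y≢1-mod-y² pr g t (trans (sym eg) (trans e′ e))

-- If the sum were prime, it would divide y, the trace, or the trace plus `frob`. It exceeds y in
-- degree, and it has the same degree as the other two, so it would equal one of them; but it is 1 +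
-- y modulo y², and they are 1. For exponents 2 and 4 the sum does equal the trace plus `frob`.
geom-pow2-composite : ∀ {y} → HasDeg y 1 → ∀ k → ¬ Prime (geom y (pow2 (3 ℕ.+ k)))
geom-pow2-composite {y} d k pr with euclid pr (geom∣trace y (2 ℕ.+ k))
... | inj₁ U∣y = geom∤y d (2≤pow2 (2 ℕ.+ k)) U∣y
... | inj₂ U∣ with euclid pr U∣
...   | inj₁ h = geom≢1-mod-y² (deg1⇒prime {y} d) (2≤pow2 (2 ℕ.+ k)) (trace-mod y k)
                   (geom-∣⇒≡ (pow2 (3 ℕ.+ k)) d (HasDeg-trace {y} d (2 ℕ.+ k)) h)
...   | inj₂ h = geom≢1-mod-y² (deg1⇒prime {y} d) (2≤pow2 (2 ℕ.+ k)) (trace+frob-mod y k)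
                   (geom-∣⇒≡ (pow2 (3 ℕ.+ k)) d
                     (HasDeg-+ {trace y (2 ℕ.+ k)} {frob y (2 ℕ.+ k)} (HasDeg-trace {y} d (2 ℕ.+ k)) (HasDeg-frob {y} d (2 ℕ.+ k))
                       (ℕ.m<m+n (pow2 (2 ℕ.+ k)) (pow2>0 (2 ℕ.+ k)))) h)

-- The pair x, x + 1

-- In characteristic 2 the relation z = 1 + y is symmetric, so whatever is proved for such a pair
-- holds with the roles of x and x + 1 exchanged.
record Complementary (y z : 𝔽₂[x]) : Set where
  field
    deg-y : HasDeg y 1
    deg-z : HasDeg z 1
    z≡1+y : z ≡ 1# + y

  prime-y : Prime y
  prime-y = deg1⇒prime {y} deg-y

  prime-z : Prime z
  prime-z = deg1⇒prime {z} deg-z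

  y∤z^ : ∀ n → ¬ y ∣ᶠ z ^ n
  y∤z^ n h = ∤-1+ prime-y ∣-refl (subst (y ∣ᶠ_) z≡1+y (prime-∣^ prime-y n h))

opaque
  complementary-sym : ∀ {y z} → Complementary y z → Complementary z y
  complementary-sym {y} C = record
    { deg-y = C.deg-z ; deg-z = C.deg-y
    ; z≡1+y = trans (solve 1 (λ y → y := con true :+ (con true :+ y)) refl y) (cong (1# +_) (sym C.z≡1+y)) }
    where module C = Complementary C

opaque
  unfolding _+_

  x-complementary : Complementary x x+1
  x-complementary = record
    { deg-y = refl , λ { (suc zero) (s≤s ()) ; (suc (suc i)) _ → refl }
    ; deg-z = refl , λ { (suc zero) (s≤s ()) ; (suc (suc i)) _ → refl }
    ; z≡1+y = refl }

∤-1+^ : ∀ {p} → Prime p → ∀ n → ¬ p ∣ᶠ 1# + p ^ suc n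
∤-1+^ {p} pr n = ∤-1+ pr (m∣m*n (p ^ n))

opaque
  split-prime-power : ∀ {p} → Prime p → ∀ m {f g h} → f * g ≡ p ^ m * h →
    ∃ λ i → ∃ λ j → ∃ λ f′ → ∃ λ g′ → i ℕ.+ j ≡ m × f ≡ p ^ i * f′ × g ≡ p ^ j * g′ × f′ * g′ ≡ h
  split-prime-power pr zero {f} {g} {h} e =
    0 , 0 , f , g , refl , sym (*-identityˡ f) , sym (*-identityˡ g) , trans e (*-identityˡ h)
  split-prime-power {p} pr (suc m) {f} {g} {h} e
    with euclid {p} {f} {g} pr (subst (p ∣ᶠ_) (sym (trans e (*-assoc p (p ^ m) h))) (m∣m*n (p ^ m * h)))
  ... | inj₁ (f₁ , refl) with split-prime-power pr m {f₁} {g} {h} (*-cancelˡ p (proj₁ pr)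
          (trans (*-extractˡ p f₁ g) (trans e (*-assoc p (p ^ m) h))))
  ...   | i , j , f′ , g′ , eq , ef , eg , e′ =
          suc i , j , f′ , g′ , cong suc eq , trans (*-comm f₁ p) (trans (cong (p *_) ef) (sym (*-assoc p (p ^ i) f′))) , eg , e′
  split-prime-power {p} pr (suc m) {f} {g} {h} e | inj₂ (g₁ , refl) with split-prime-power pr m {f} {g₁} {h} (*-cancelˡ p (proj₁ pr)
          (trans (*-extractʳ p f g₁) (trans e (*-assoc p (p ^ m) h))))
  ...   | i , j , f′ , g′ , eq , ef , eg , e′ =
          i , suc j , f′ , g′ , trans (ℕ.+-suc i j) (cong suc eq) , ef , trans (*-comm g₁ p) (trans (cong (p *_) eg) (sym (*-assoc p (p ^ j) g′))) , e′

opaque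
  split-two-prime-powers : ∀ {p q} → Prime p → Prime q → ∀ m n {f g} → f * g ≡ p ^ m * q ^ n →
    ∃ λ i → ∃ λ j → ∃ λ c → ∃ λ d → i ℕ.+ j ≡ m × c ℕ.+ d ≡ n × f ≡ p ^ i * q ^ c × g ≡ p ^ j * q ^ d
  split-two-prime-powers {p} {q} pr qr m n e with split-prime-power pr m e
  ... | i , j , f′ , g′ , ij , refl , refl , e′ with split-prime-power qr n {f′} {g′} {1#} (trans e′ (sym (*-identityʳ (q ^ n))))
  ...   | c , d , f″ , g″ , cd , refl , refl , e″ =
    i , j , c , d , ij , cd ,
    cong (p ^ i *_) (trans (cong (q ^ c *_) (*≡1⇒≡1 (trans (*-comm g″ f″) e″))) (*-identityʳ (q ^ c))) ,
    cong (p ^ j *_) (trans (cong (q ^ d *_) (*≡1⇒≡1 e″)) (*-identityʳ (q ^ d)))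

opaque
  -- The primes 1 + yⁱ zᶜ play the part of Mersenne primes. Multiplying by z and applying
  -- `geom-even` gives yⁱ zᶜ⁺¹ = y (1 + yⁿ)². The exponent of y shows i = 1, the degree shows c + 1
  -- = 2n, and a square root gives the last equation.
  mersenne-shape : ∀ {y z} → Complementary y z → ∀ a i c → let n = suc a in
    1# + geom y (n ℕ.+ n) ≡ y ^ i * z ^ c → i ≡ 1 × suc c ≡ n ℕ.+ n × z ^ n ≡ 1# + y ^ n
  mersenne-shape {y} {z} C a i c e = i≡1 , c≡ ,
    square-injective (trans (sym (^-square z n)) (trans (cong (z ^_) (sym c≡)) z^c≡))
    where
    open Complementary C
    n : ℕ
    n = suc a
    w : 𝔽₂[x]
    w = 1# + y ^ n
    eq : y ^ i * z ^ suc c ≡ y ^ 1 * (w * w)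
    eq = begin
      y ^ i * (z * z ^ c)            ≡⟨ solve 3 (λ u z v → u :* (z :* v) := z :* (u :* v)) refl (y ^ i) z (z ^ c) ⟩
      z * (y ^ i * z ^ c)            ≡⟨ cong (z *_) e ⟨
      z * (1# + geom y (n ℕ.+ n))    ≡⟨ cong (_* (1# + geom y (n ℕ.+ n))) z≡1+y ⟩
      (1# + y) * (1# + geom y (n ℕ.+ n)) ≡⟨ geom-even y n ⟩
      y * (w * w)                    ≡⟨ cong (_* (w * w)) (*-identityʳ y) ⟨
      y ^ 1 * (w * w)                ∎
      where open ≡-Reasoning
    i≡1 : i ≡ 1
    i≡1 = valuation-unique prime-y i 1 (y∤z^ (suc c)) (∤-* prime-y (∤-1+^ prime-y a) (∤-1+^ prime-y a)) eq
    z^c≡ : z ^ suc c ≡ w * w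
    z^c≡ = *-cancelˡ (y ^ 1) (^-≢0 (proj₁ prime-y) 1) (trans (cong (λ k → y ^ k * z ^ suc c) (sym i≡1)) eq)
    dw : HasDeg w n
    dw = HasDeg-1+ {y ^ n} (HasDeg-^ {y} deg-y n)
    c≡ : suc c ≡ n ℕ.+ n
    c≡ = HasDegᶜ-unique (HasDeg-^ {z} deg-z (suc c))
           (subst (λ t → HasDeg t (n ℕ.+ n)) (sym z^c≡) (HasDeg-* {w} {w} dw dw))

opaque
  mersenne-geom : ∀ {y z} → Complementary y z → ∀ a i c → let n = suc a in
    Prime (geom y (n ℕ.+ n)) → 1# + geom y (n ℕ.+ n) ≡ y ^ i * z ^ c →
    i ≡ 1 × (n ≡ 1 × c ≡ 1 ⊎ n ≡ 2 × c ≡ 3)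
  mersenne-geom {y} {z} C a i c pr e with mersenne-shape C a i c e
  ... | i≡1 , c≡ , e′ with freshman⇒pow2 (Complementary.prime-y C) a (trans (cong (_^ suc a) (sym (Complementary.z≡1+y C))) e′)
  ...   | zero , refl = i≡1 , inj₁ (refl , ℕ.suc-injective c≡)
  ...   | suc zero , refl = i≡1 , inj₂ (refl , ℕ.suc-injective c≡)
  ...   | suc (suc k) , n≡ = ⊥-elim (geom-pow2-composite (Complementary.deg-y C) k
            (subst (λ n → Prime (geom y (n ℕ.+ n))) n≡ pr))

-- In terms of z the factors are 1 + zᶜ + zᶜ⁺¹ and 1 + zᵈ + zᵈ⁺²; comparing their product
-- with 1 + z + z² + z³ + ⋯ modulo z⁴ leaves only the possibilities (c , d) = (2 , 1), (1 , 3).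
opaque
  trinomials : ∀ {z} → Prime z → ∀ c d b → 3 ℕ.+ (suc c ℕ.+ suc d) ≡ b ℕ.+ b → let y = 1# + z in
    (1# + y * z ^ suc c) * (1# + y ^ 2 * z ^ suc d) ≡ geom z (3 ℕ.+ (suc c ℕ.+ suc d)) → c ≡ 1 × d ≡ 0
  trinomials {z} pr 1 0 b par e = refl , refl
  -- Exponents 1 and 3 pass the test modulo z⁴, since (1 + z + z²)(1 + z³ + z⁵) agrees with the
  -- geometric sum up to z³. Parity excludes them: 3 + 1 + 3 is odd.
  trinomials {z} pr 0 2 b par e = ⊥-elim (odd≢even 3 b par)
  -- In this and the following cases the sum of both sides, which `e` makes zero, is written as z,
  -- z² or z³ times some 1 + z (⋯). The exponent is the first position at which the two sides
  -- differ.
  trinomials {z} pr 0 0 b par e = ⊥-elim (*-≢0 (proj₁ pr) (1+p*≢0 pr _) (trans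
    (solve 2 (λ z g → let y = con true :+ z in
       z :* (con true :+ z :* (con true :+ z :* g :+ z :^ 2 :+ z :^ 3)) :=
       (con true :+ y :* z :^ 1) :* (con true :+ y :^ 2 :* z :^ 1) :+ (con true :+ z :* (con true :+ z :* (con true :+ z :* g)))) refl z (geom z 2))
    (trans (cong (_+ geom z 5) e) (+-self _))))
  trinomials {z} pr 0 1 b par e = ⊥-elim (*-≢0 (*-≢0 (proj₁ pr) (proj₁ pr)) (1+p*≢0 pr _) (trans
    (solve 2 (λ z g → let y = con true :+ z in
       z :* z :* (con true :+ z :* (con true :+ g :+ z :^ 2 :+ z :^ 3)) :=
       (con true :+ y :* z :^ 1) :* (con true :+ y :^ 2 :* z :^ 2) :+ (con true :+ z :* (con true :+ z :* (con true :+ z :* g)))) refl z (geom z 3))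
    (trans (cong (_+ geom z 6) e) (+-self _))))
  trinomials {z} pr 0 (suc (suc (suc d))) b par e = ⊥-elim (*-≢0 (^-≢0 (proj₁ pr) 3) (1+p*≢0 pr _) (trans
    (solve 3 (λ z g u → let y = con true :+ z in
       z :^ 3 :* (con true :+ z :* (g :+ y :^ 2 :* (con true :+ z :+ z :^ 2) :* u)) :=
       (con true :+ y :* z :^ 1) :* (con true :+ y :^ 2 :* (z :* (z :* (z :* (z :* u))))) :+
       (con true :+ z :* (con true :+ z :* (con true :+ z :* (con true :+ z :* g))))) refl z (geom z (4 ℕ.+ d)) (z ^ d))
    (trans (cong (_+ geom z (8 ℕ.+ d)) e) (+-self _))))
  trinomials {z} pr (suc (suc c)) 0 b par e = ⊥-elim (*-≢0 (*-≢0 (proj₁ pr) (proj₁ pr)) (1+p*≢0 pr _) (trans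
    (solve 3 (λ z g u → let y = con true :+ z in
       z :* z :* (con true :+ z :* (g :+ con true :+ y :* u :* (con true :+ z :+ z :^ 3))) :=
       (con true :+ y :* (z :* (z :* (z :* u)))) :* (con true :+ y :^ 2 :* z :^ 1) :+
       (con true :+ z :* (con true :+ z :* (con true :+ z :* g)))) refl z (geom z (suc (suc (suc c)) ℕ.+ 1)) (z ^ c))
    (trans (cong (_+ geom z (3 ℕ.+ (suc (suc (suc c)) ℕ.+ 1))) e) (+-self _))))
  trinomials {z} pr (suc c) (suc d) b par e = ⊥-elim (*-≢0 (proj₁ pr) (1+p*≢0 pr _) (trans
    (solve 4 (λ z g u v → let y = con true :+ z in
       z :* (con true :+ z :* (con true :+ z :* g :+ y :* u :+ y :^ 2 :* v :+ y :* y :^ 2 :* z :^ 2 :* u :* v)) :=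
       (con true :+ y :* (z :* (z :* u))) :* (con true :+ y :^ 2 :* (z :* (z :* v))) :+
       (con true :+ z :* (con true :+ z :* (con true :+ z :* g)))) refl z (geom z (suc (suc c) ℕ.+ suc (suc d))) (z ^ c) (z ^ d))
    (trans (cong (_+ geom z (3 ℕ.+ (suc (suc c) ℕ.+ suc (suc d)))) e) (+-self _))))

opaque
  pos-exponent : ∀ {y z} → Complementary y z → ∀ i c {f} → y ∣ᶠ f → f ≡ y ^ i * z ^ c → ∃ λ j → i ≡ suc j
  pos-exponent {y} {z} C zero c h refl = ⊥-elim (Complementary.y∤z^ C c (subst (y ∣ᶠ_) (*-identityˡ (z ^ c)) h))
  pos-exponent C (suc j) c h e = j , refl

opaque
  1+-involutive : ∀ {f g} → 1# + f ≡ g → f ≡ 1# + g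
  1+-involutive {f} e = trans (solve 1 (λ f → f := con true :+ (con true :+ f)) refl f) (cong (1# +_) e)

opaque
  trinomial-case : ∀ {y z} → Complementary y z → ∀ c d m {p q} → 3 ℕ.+ (suc c ℕ.+ suc d) ≡ m ℕ.+ m →
    p * q ≡ geom z (m ℕ.+ m) → 1# + p ≡ y ^ 1 * z ^ suc c → 1# + q ≡ y ^ 2 * z ^ suc d → m ≡ 3
  trinomial-case {y} {z} C c d m {p} {q} par e ep eq with trinomials (Complementary.prime-z C) c d m par
    (trans (cong₂ _*_ ep′ eq′) (trans e (cong (geom z) (sym par))))
    where
    y≡1+z : y ≡ 1# + z
    y≡1+z = Complementary.z≡1+y (complementary-sym C)
    ep′ : 1# + (1# + z) * z ^ suc c ≡ p
    ep′ = sym (trans (1+-involutive ep) (cong (λ t → 1# + t * z ^ suc c) (trans (*-identityʳ y) y≡1+z)))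
    eq′ : 1# + (1# + z) ^ 2 * z ^ suc d ≡ q
    eq′ = sym (trans (1+-involutive eq) (cong (λ t → 1# + t ^ 2 * z ^ suc d) y≡1+z))
  ... | refl , refl = trans (ℕ.n≡⌊n+n/2⌋ m) (cong ℕ.⌊_/2⌋ (sym par))

sum≡1 : ∀ i j → 1 ℕ.+ (suc i ℕ.+ suc j) ≡ 4 → i ≡ 0 × j ≡ 1 ⊎ i ≡ 1 × j ≡ 0
sum≡1 i j e = go i j (ℕ.suc-injective (trans (sym (ℕ.+-suc i j)) (ℕ.suc-injective (ℕ.suc-injective e))))
  where
  go : ∀ i j → i ℕ.+ j ≡ 1 → i ≡ 0 × j ≡ 1 ⊎ i ≡ 1 × j ≡ 0
  go zero j e = inj₁ (refl , e)
  go (suc zero) zero e = inj₂ (refl , refl)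

opaque
  -- Counting exponents of y: 1 + U contributes exactly one, 1 + p and 1 + q at least one each, and
  -- the total is 2n with n at most 2. Hence n = 2, and p and q take 1 and 2 in some order;
  -- `trinomial-case` then fixes m from the exponents of z.
  one-plus-two : ∀ {y z} → Complementary y z → ∀ a b {p q} → let n = suc a ; m = suc b in
    Prime (geom y (n ℕ.+ n)) → p * q ≡ geom z (m ℕ.+ m) →
    y ∣ᶠ 1# + p → z ∣ᶠ 1# + p → y ∣ᶠ 1# + q → z ∣ᶠ 1# + q →
    (1# + geom y (n ℕ.+ n)) * ((1# + p) * (1# + q)) ≡ y ^ (n ℕ.+ n) * z ^ (m ℕ.+ m) →
    n ≡ 2 × m ≡ 3
  one-plus-two {y} {z} C a b {p} {q} pr epq yp zp yq zq e
    with split-two-prime-powers (Complementary.prime-y C) (Complementary.prime-z C) (suc a ℕ.+ suc a) (suc b ℕ.+ suc b) e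
  ... | i , j , c₀ , d₀ , ij , cd , eU , e′
    with split-two-prime-powers (Complementary.prime-y C) (Complementary.prime-z C) j d₀ e′
  ... | i₁ , j₁ , c , d , refl , refl , ep , eq
    with pos-exponent C i₁ c yp ep | pos-exponent C j₁ d yq eq
       | pos-exponent (complementary-sym C) c i₁ zp (trans ep (*-comm (y ^ i₁) (z ^ c)))
       | pos-exponent (complementary-sym C) d j₁ zq (trans eq (*-comm (y ^ j₁) (z ^ d)))
       | mersenne-geom C a i c₀ pr eU
  -- For n = 1 the total exponent of y is 2, too small for three positive contributions.
  ... | i′ , refl | j′ , refl | c′ , refl | d′ , refl | refl , inj₁ (refl , refl)
    with () ← trans (sym (ℕ.suc-injective (ℕ.suc-injective ij))) (ℕ.+-suc i′ j′)
  ... | i′ , refl | j′ , refl | c′ , refl | d′ , refl | refl , inj₂ (refl , refl) with sum≡1 i′ j′ ij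
  ... | inj₁ (refl , refl) = refl , trinomial-case C c′ d′ (suc b) cd epq ep eq
  ... | inj₂ (refl , refl) =
        refl , trinomial-case C d′ c′ (suc b) (trans (cong (3 ℕ.+_) (ℕ.+-comm (suc d′) (suc c′))) cd)
                 (trans (*-comm q p) epq) eq ep

opaque
  -- The factor 1 + U contributes exponent 1 of y and 1 + V contributes 2m - 1, so the total 2n
  -- forces n = m.
  two-primes : ∀ {y z} → Complementary y z → ∀ a b → let n = suc a ; m = suc b in
    Prime (geom y (n ℕ.+ n)) → Prime (geom z (m ℕ.+ m)) →
    (1# + geom y (n ℕ.+ n)) * (1# + geom z (m ℕ.+ m)) ≡ y ^ (n ℕ.+ n) * z ^ (m ℕ.+ m) →
    n ≡ 1 × m ≡ 1 ⊎ n ≡ 2 × m ≡ 2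
  two-primes {y} {z} C a b prU prV e
    with split-two-prime-powers (Complementary.prime-y C) (Complementary.prime-z C) (suc a ℕ.+ suc a) (suc b ℕ.+ suc b) e
  ... | i , j , c , d , ij , cd , eU , eV
    with mersenne-geom C a i c prU eU
       | mersenne-geom (complementary-sym C) b d j prV (trans eV (*-comm (y ^ j) (z ^ d)))
  ... | refl , inj₁ (refl , refl) | refl , inj₁ (refl , refl) = inj₁ (refl , refl)
  ... | refl , inj₂ (refl , refl) | refl , inj₂ (refl , refl) = inj₂ (refl , refl)
  ... | refl , inj₁ (refl , refl) | refl , inj₂ (refl , refl) with () ← ij
  ... | refl , inj₂ (refl , refl) | refl , inj₁ (refl , refl) with () ← ij

-- Square obstructions to a further factor

geom-even-y : ∀ {y z} → Complementary y z → ∀ n → z * (1# + geom y (n ℕ.+ n)) ≡ y * ((1# + y ^ n) * (1# + y ^ n))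
geom-even-y {y} C n = trans (cong (_* (1# + geom y (n ℕ.+ n))) (Complementary.z≡1+y C)) (geom-even y n)

1+^≢0 : ∀ {p} → Prime p → ∀ n → 1# + p ^ suc n ≢ 0#
1+^≢0 pr n = ∤⇒≢0 (∤-1+^ pr n)

-- Multiplication by y z (1 + q) lets `geom-even` act on all three factors. The y and z contributed
-- by the first two cancel, and one more factor 1 + q leaves (f (1 + q))² = (u v w)² q (1 + q).
three-geoms : ∀ {y z q} → Complementary y z → Prime q → ∀ a b c {f} → let n = suc a ; m = suc b ; k = suc c in
  f * f ≢ (1# + geom y (n ℕ.+ n)) * ((1# + geom z (m ℕ.+ m)) * (1# + geom q (k ℕ.+ k)))
three-geoms {y} {z} {q} C pr a b c {f} e =
  square*q[1+q]≢square pr (*-≢0 (1+^≢0 prime-y a) (*-≢0 (1+^≢0 prime-z b) (1+^≢0 pr c)))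
    (*-cancelˡ (y * z) (*-≢0 (proj₁ prime-y) (proj₁ prime-z)) (begin
      y * z * (u * (v * w) * (u * (v * w)) * (q * (1# + q)))
        ≡⟨ solve 6 (λ y z q u v w → y :* z :* (u :* (v :* w) :* (u :* (v :* w)) :* (q :* (con true :+ q))) :=
             y :* (u :* u) :* (z :* (v :* v)) :* (q :* (w :* w)) :* (con true :+ q)) refl y z q u v w ⟩
      y * (u * u) * (z * (v * v)) * (q * (w * w)) * (1# + q)
        ≡⟨ cong₂ (λ s t → s * t * (1# + q)) (cong₂ _*_ (geom-even-y C (suc a)) (geom-even-y (complementary-sym C) (suc b))) (geom-even q (suc c)) ⟨
      z * (1# + U) * (y * (1# + V)) * ((1# + q) * (1# + W)) * (1# + q)
        ≡⟨ solve 6 (λ y z q U V W → z :* U :* (y :* V) :* ((con true :+ q) :* W) :* (con true :+ q) :=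
             y :* z :* (U :* (V :* W) :* ((con true :+ q) :* (con true :+ q)))) refl y z q (1# + U) (1# + V) (1# + W) ⟩
      y * z * ((1# + U) * ((1# + V) * (1# + W)) * ((1# + q) * (1# + q)))
        ≡⟨ cong (λ t → y * z * (t * ((1# + q) * (1# + q)))) e ⟨
      y * z * (f * f * ((1# + q) * (1# + q)))
        ≡⟨ solve 3 (λ t f r → t :* (f :* f :* (r :* r)) := t :* (f :* r :* (f :* r))) refl (y * z) f (1# + q) ⟩
      y * z * (f * (1# + q) * (f * (1# + q))) ∎))
  where
  open ≡-Reasoning
  open Complementary C
  u v w U V W : 𝔽₂[x]
  u = 1# + y ^ suc a
  v = 1# + z ^ suc b
  w = 1# + q ^ suc c
  U = geom y (suc a ℕ.+ suc a)
  V = geom z (suc b ℕ.+ suc b)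
  W = geom q (suc c ℕ.+ suc c)

-- The same cancellation of y z, followed by multiplication by q, gives (f q)² = (u v)² q (1 + q).
two-geoms-and-prime : ∀ {y z q} → Complementary y z → Prime q → ∀ a b {f} → let n = suc a ; m = suc b in
  f * f * q ≢ (1# + geom y (n ℕ.+ n)) * ((1# + geom z (m ℕ.+ m)) * (1# + q))
two-geoms-and-prime {y} {z} {q} C pr a b {f} e =
  square*q[1+q]≢square pr (*-≢0 (1+^≢0 prime-y a) (1+^≢0 prime-z b))
    (*-cancelˡ (y * z) (*-≢0 (proj₁ prime-y) (proj₁ prime-z)) (begin
      y * z * (u * v * (u * v) * (q * (1# + q)))
        ≡⟨ solve 5 (λ y z q u v → y :* z :* (u :* v :* (u :* v) :* (q :* (con true :+ q))) :=
             y :* (u :* u) :* (z :* (v :* v)) :* (q :* (con true :+ q))) refl y z q u v ⟩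
      y * (u * u) * (z * (v * v)) * (q * (1# + q))
        ≡⟨ cong₂ (λ s t → s * t * (q * (1# + q))) (geom-even-y C (suc a)) (geom-even-y (complementary-sym C) (suc b)) ⟨
      z * (1# + U) * (y * (1# + V)) * (q * (1# + q))
        ≡⟨ solve 5 (λ y z q U V → z :* U :* (y :* V) :* (q :* (con true :+ q)) :=
             y :* z :* (U :* (V :* (con true :+ q)) :* q)) refl y z q (1# + U) (1# + V) ⟩
      y * z * ((1# + U) * ((1# + V) * (1# + q)) * q)
        ≡⟨ cong (λ t → y * z * (t * q)) e ⟨
      y * z * (f * f * q * q)
        ≡⟨ solve 3 (λ t f r → t :* (f :* f :* r :* r) := t :* (f :* r :* (f :* r))) refl (y * z) f q ⟩
      y * z * (f * q * (f * q)) ∎))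
  where
  open ≡-Reasoning
  open Complementary C
  u v U V : 𝔽₂[x]
  u = 1# + y ^ suc a
  v = 1# + z ^ suc b
  U = geom y (suc a ℕ.+ suc a)
  V = geom z (suc b ℕ.+ suc b)

∣∏⁺ : ∀ {y ps} → All (λ p → y ∣ᶠ 1# + p) ps → 1 ≤ length ps → y ∣ᶠ ∏⁺ ps
∣∏⁺ {y} {p ∷ ps} (h ∷ _) _ = subst (y ∣ᶠ_) (*-comm (∏⁺ ps) (1# + p)) (∣-* (∏⁺ ps) h)

∤∏ : ∀ {y ps} → Prime y → All (λ p → ¬ y ∣ᶠ p) ps → ¬ y ∣ᶠ ∏ ps
∤∏ pr [] h = prime∤1 pr h
∤∏ pr (n ∷ ns) h = ∤-* pr n (∤∏ pr ns) h

valuation-pos : ∀ {p} → Prime p → ∀ f → f ≢ 0# → p ∣ᶠ f → ∃ λ a → ∃ λ g → f ≡ p ^ suc a * g × ¬ p ∣ᶠ g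
valuation-pos pr f f≢0 p∣f with valuation pr f f≢0
... | zero , g , refl , p∤g = ⊥-elim (p∤g (subst (_ ∣ᶠ_) (*-identityˡ g) p∣f))
... | suc a , g , e , p∤g = a , g , e , p∤g

sigma-square : ∀ {p} → Prime p → ∀ n {f} → ¬ p ∣ᶠ f →
  sigma (p ^ n * f * (p ^ n * f)) ≡ geom p (n ℕ.+ n) * sigma (f * f)
sigma-square {p} pr n {f} p∤f = trans (cong sigma (*^-square p n f)) (sigma-prime-power pr (n ℕ.+ n) (∤-* pr p∤f p∤f))

-- `M5a` and `M5b` do not arise: they contain x or x + 1 to the first power, whereas in B² times odd
-- primes both exponents are even.
Listed : 𝔽₂[x] → Set
Listed f = f ≡ [ M16 ] ⊎ f ≡ [ M20a ] ⊎ f ≡ [ M20b ]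

opaque
  unfolding _+_ _*_

  -- The polynomial x² + x + 1 is invariant under x ↦ x + 1, so n = m = 1 would repeat a prime.
  geom-2-symmetric : geom x 2 ≡ geom x+1 2
  geom-2-symmetric = refl

  M16-factors : let B = x ^ 2 * (x+1 ^ 2 * 1#) in B * B * (geom x 4 * (geom x+1 4 * 1#)) ≡ [ M16 ]
  M16-factors = refl

  M20a-factors : let B = x ^ 2 * (x+1 ^ 3 * 1#) in B * B * (geom x 4 * (geom x+1 6 * 1#)) ≡ [ M20a ]
  M20a-factors = refl

  M20b-factors : let B = x ^ 3 * (x+1 ^ 2 * 1#) in B * B * (geom x 6 * (geom x+1 4 * 1#)) ≡ [ M20b ]
  M20b-factors = refl

-- The classification

-- The values 1 at 0 and at 1 are recorded as divisibilities of 1 + p, which is what the factors of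
-- σ need.
OddPrime : 𝔽₂[x] → Set
OddPrime p = Prime p × x ∣ᶠ 1# + p × x+1 ∣ᶠ 1# + p

Unique-resp-↭ : ∀ {ps qs : List 𝔽₂[x]} → ps ↭ qs → Unique ps → Unique qs
Unique-resp-↭ π = PermSetoid.AllPairs-resp-↭ (setoid 𝔽₂[x]) ≢-sym (resp₂ _≢_) (↭⇒↭ₛ π)

opaque
  ∏-split₃ : ∀ {ps} → All Prime ps → ∀ {f g h} → f * (g * h) ≡ ∏ ps →
    ∃ λ ks → ∃ λ ls → ∃ λ ms → ps ↭ ks ++ (ls ++ ms) × f ≡ ∏ ks × g ≡ ∏ ls × h ≡ ∏ ms
  ∏-split₃ prs e with ∏-split prs e
  ... | ks , ns , π , ef , egh with ∏-split (All.++⁻ʳ ks (All-resp-↭ π prs)) egh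
  ...   | ls , ms , ρ , eg , eh = ks , ls , ms , ↭-trans π (++⁺ˡ ks ρ) , ef , eg , eh

singleton : ∀ {f p} → f ≡ ∏ (p ∷ []) → p ≡ f
singleton {p = p} e = sym (trans e (*-identityʳ p))

-- As U and V differ from 1, at most three primes can be distributed over U, V, r only as (1, 1, 0),
-- (1, 1, 1), (1, 2, 0) or (2, 1, 0). The second is impossible by `two-geoms-and-prime`; the others
-- lead to M16, M20a and M20b.
two-prime-factors : ∀ a b {ps r} → let n = suc a ; m = suc b ; B = x ^ n * (x+1 ^ m * 1#) in
  All OddPrime ps → Unique ps → length ps ≤ 3 →
  geom x (n ℕ.+ n) * (geom x+1 (m ℕ.+ m) * r) ≡ ∏ ps → B * B * r ≡ ∏⁺ ps → Listed (B * B * ∏ ps)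
two-prime-factors a b {ps} {r} odd unique len eσ eB with ∏-split₃ (All.map proj₁ odd) eσ
... | us , vs , rs , π , eu , ev , er = analyse us vs rs π bound eu ev er
  where
  C = x-complementary
  open Complementary C
  n m : ℕ
  n = suc a
  m = suc b
  B U V : 𝔽₂[x]
  B = x ^ n * (x+1 ^ m * 1#)
  U = geom x (n ℕ.+ n)
  V = geom x+1 (m ℕ.+ m)

  B² : B * B ≡ x ^ (n ℕ.+ n) * x+1 ^ (m ℕ.+ m)
  B² = begin
    B * B                                              ≡⟨ cong (λ t → x ^ n * t * (x ^ n * t)) (*-identityʳ (x+1 ^ m)) ⟩
    x ^ n * x+1 ^ m * (x ^ n * x+1 ^ m)                ≡⟨ *^-square x n (x+1 ^ m) ⟩
    x ^ (n ℕ.+ n) * (x+1 ^ m * x+1 ^ m)                ≡⟨ cong (x ^ (n ℕ.+ n) *_) (^-square x+1 m) ⟨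
    x ^ (n ℕ.+ n) * x+1 ^ (m ℕ.+ m)                    ∎
    where open ≡-Reasoning

  bound : length us ℕ.+ (length vs ℕ.+ length rs) ≤ 3
  bound = subst (_≤ 3) (trans (↭-length π) (trans (List.length-++ us) (cong (length us ℕ.+_) (List.length-++ vs)))) len

  value : r ≡ 1# → B * B * ∏ ps ≡ B * B * (U * (V * 1#))
  value r≡1 = cong (B * B *_) (trans (sym eσ) (cong (λ t → U * (V * t)) r≡1))

  B²≡ : ∀ {qs} → r ≡ 1# → ps ↭ qs → ∏⁺ qs ≡ x ^ (n ℕ.+ n) * x+1 ^ (m ℕ.+ m)
  B²≡ r≡1 ρ = trans (sym (∏⁺-↭ ρ)) (trans (sym eB) (trans (cong (B * B *_) r≡1) (trans (*-identityʳ (B * B)) B²)))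

  1∙1 : ∀ {s t} → s * (t * 1#) ≡ s * t
  1∙1 {s} {t} = cong (s *_) (*-identityʳ t)

  1∙1∙1 : ∀ {s t w} → s * (t * (w * 1#)) ≡ s * (t * w)
  1∙1∙1 {s} = cong (s *_) 1∙1

  analyse : ∀ us vs rs → ps ↭ us ++ (vs ++ rs) → length us ℕ.+ (length vs ℕ.+ length rs) ≤ 3 →
            U ≡ ∏ us → V ≡ ∏ vs → r ≡ ∏ rs → Listed (B * B * ∏ ps)
  analyse [] vs rs ρ _ eu ev er = ⊥-elim (geom-≢1 prime-y (a ℕ.+ suc a) eu)
  analyse (_ ∷ _) [] rs ρ _ eu ev er = ⊥-elim (geom-≢1 prime-z (b ℕ.+ suc b) ev)
  analyse (u ∷ []) (v ∷ []) [] ρ _ eu ev er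
    with singleton {U} eu | singleton {V} ev | All-resp-↭ ρ odd | Unique-resp-↭ ρ unique
  ... | refl | refl | (pU , _) ∷ (pV , _) ∷ [] | (U≢V ∷ []) ∷ _
    with two-primes C a b pU pV (trans (sym 1∙1) (B²≡ er ρ))
  ... | inj₁ (refl , refl) = ⊥-elim (U≢V geom-2-symmetric)
  ... | inj₂ (refl , refl) = inj₁ (trans (value er) M16-factors)
  analyse (u ∷ []) (v ∷ []) (w ∷ []) ρ _ eu ev er
    with singleton {U} eu | singleton {V} ev | singleton {r} er | All-resp-↭ ρ odd
  ... | refl | refl | refl | _ ∷ _ ∷ (pw , _) ∷ [] =
    ⊥-elim (two-geoms-and-prime C pw a b {B} (trans eB (trans (∏⁺-↭ ρ) 1∙1∙1)))
  analyse (u ∷ []) (v ∷ v′ ∷ []) [] ρ _ eu ev er with singleton {U} eu | All-resp-↭ ρ odd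
  ... | refl | (pU , _) ∷ (_ , yv , zv) ∷ (_ , yv′ , zv′) ∷ []
    with one-plus-two C a b pU (sym (trans ev 1∙1)) yv zv yv′ zv′ (trans (sym 1∙1∙1) (B²≡ er ρ))
  ... | refl , refl = inj₂ (inj₁ (trans (value er) M20a-factors))
  -- The mirror image of the preceding case: x and x + 1 are exchanged, and the factors are
  -- reordered to match.
  analyse (u ∷ u′ ∷ []) (v ∷ []) [] ρ _ eu ev er with singleton {V} ev | All-resp-↭ ρ odd
  ... | refl | (_ , yu , zu) ∷ (_ , yu′ , zu′) ∷ (pV , _) ∷ []
    with one-plus-two (complementary-sym C) b a pV (sym (trans eu 1∙1)) zu yu zu′ yu′
           (trans (trans (*-comm _ _) (trans (*-assoc _ _ _) (sym 1∙1∙1))) (trans (B²≡ er ρ) (*-comm _ _)))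
  ... | refl , refl = inj₂ (inj₂ (trans (value er) M20b-factors))
  analyse (_ ∷ []) (_ ∷ []) (_ ∷ _ ∷ _) _ (s≤s (s≤s (s≤s ()))) _ _ _
  analyse (_ ∷ []) (_ ∷ _ ∷ []) (_ ∷ _) _ (s≤s (s≤s (s≤s ()))) _ _ _
  analyse (_ ∷ []) (_ ∷ _ ∷ _ ∷ _) _ _ (s≤s (s≤s (s≤s ()))) _ _ _
  analyse (_ ∷ _ ∷ []) (_ ∷ []) (_ ∷ _) _ (s≤s (s≤s (s≤s ()))) _ _ _
  analyse (_ ∷ _ ∷ []) (_ ∷ _ ∷ _) _ _ (s≤s (s≤s (s≤s ()))) _ _ _
  analyse (_ ∷ _ ∷ us@(_ ∷ _)) (v ∷ vs) rs _ (s≤s (s≤s le)) _ _ _ =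
    ⊥-elim (ℕ.<⇒≱ (s≤s (ℕ.m≤n+m (suc (length vs ℕ.+ length rs)) _)) (ℕ.≤-trans le (s≤s z≤n)))

-- Here `s` gathers whatever is left besides U, V and W, namely σ of the rest of B² times r. Three
-- factors other than 1 use up all the primes, one each, so s = 1 and therefore r = 1, which leaves
-- the situation of `three-geoms`.
three-prime-factors : ∀ a b c {q s ps f} → let n = suc a ; m = suc b ; k = suc c in
  Prime q → All Prime ps → length ps ≤ 3 →
  geom x (n ℕ.+ n) * (geom x+1 (m ℕ.+ m) * (geom q (k ℕ.+ k) * s)) ≡ ∏ ps →
  ∀ t r → s ≡ t * r → f * f * r ≢ ∏⁺ ps
three-prime-factors a b c {q} {s} {ps} {f} qr prs len eσ t r es eB with ∏-split₃ prs eσ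
... | us , vs , ns , π , eu , ev , en with ∏-split (All.++⁻ʳ vs (All.++⁻ʳ us (All-resp-↭ π prs))) en
... | ws , rs , ρ , ew , er = analyse us vs ws rs τ bound eu ev ew er
  where
  open Complementary x-complementary
  U V W : 𝔽₂[x]
  U = geom x (suc a ℕ.+ suc a)
  V = geom x+1 (suc b ℕ.+ suc b)
  W = geom q (suc c ℕ.+ suc c)

  τ : ps ↭ us ++ (vs ++ (ws ++ rs))
  τ = ↭-trans π (++⁺ˡ us (++⁺ˡ vs ρ))

  bound : length us ℕ.+ (length vs ℕ.+ (length ws ℕ.+ length rs)) ≤ 3
  bound = subst (_≤ 3) (trans (↭-length τ) (trans (List.length-++ us) (cong (length us ℕ.+_)
    (trans (List.length-++ vs) (cong (length vs ℕ.+_) (List.length-++ ws)))))) len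

  analyse : ∀ us vs ws rs → ps ↭ us ++ (vs ++ (ws ++ rs)) →
            length us ℕ.+ (length vs ℕ.+ (length ws ℕ.+ length rs)) ≤ 3 →
            U ≡ ∏ us → V ≡ ∏ vs → W ≡ ∏ ws → s ≡ ∏ rs → ⊥
  analyse [] _ _ _ _ _ eu _ _ _ = geom-≢1 prime-y (a ℕ.+ suc a) eu
  analyse (_ ∷ _) [] _ _ _ _ _ ev _ _ = geom-≢1 prime-z (b ℕ.+ suc b) ev
  analyse (_ ∷ _) (_ ∷ _) [] _ _ _ _ _ ew _ = geom-≢1 qr (c ℕ.+ suc c) ew
  analyse (u ∷ []) (v ∷ []) (w ∷ []) [] τ _ eu ev ew er
    with singleton {U} eu | singleton {V} ev | singleton {W} ew
  ... | refl | refl | refl = three-geoms x-complementary qr a b c {f} (begin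
    f * f                                 ≡⟨ *-identityʳ (f * f) ⟨
    f * f * 1#                            ≡⟨ cong (f * f *_) (*≡1⇒≡1 (trans (sym es) er)) ⟨
    f * f * r                             ≡⟨ eB ⟩
    ∏⁺ ps                                 ≡⟨ ∏⁺-↭ τ ⟩
    (1# + U) * ((1# + V) * ((1# + W) * 1#)) ≡⟨ cong (λ t → (1# + U) * ((1# + V) * t)) (*-identityʳ (1# + W)) ⟩
    (1# + U) * ((1# + V) * (1# + W))      ∎)
    where open ≡-Reasoning
  analyse (_ ∷ []) (_ ∷ []) (_ ∷ []) (_ ∷ _) _ (s≤s (s≤s (s≤s ())))
  analyse (_ ∷ []) (_ ∷ []) (_ ∷ _ ∷ _) _ _ (s≤s (s≤s (s≤s ())))
  analyse (_ ∷ []) (_ ∷ _ ∷ vs) (_ ∷ _) _ _ (s≤s (s≤s (s≤s le))) with () ← ℕ.m+n≤o⇒n≤o (length vs) le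
  analyse (_ ∷ _ ∷ us) (_ ∷ vs) (_ ∷ _) _ _ (s≤s (s≤s le)) with ℕ.m+n≤o⇒n≤o (length us) le
  ... | s≤s le′ with () ← ℕ.m+n≤o⇒n≤o (length vs) le′

∏-≢0 : ∀ {ps} → All Prime ps → ∏ ps ≢ 0#
∏-≢0 [] = 1≢0
∏-≢0 (pr ∷ prs) = *-≢0 (proj₁ pr) (∏-≢0 prs)

opaque
  -- Being coprime to f, the divisor s of f ∏ ps already divides ∏ ps; cancelling s from the
  -- equation then gives the second claim.
  cofactor : ∀ {f s ps} → All Prime ps → Coprime s f → s * ∏⁺ ps ≡ f * ∏ ps →
    ∃ λ r → ∏ ps ≡ r * s × f * r ≡ ∏⁺ ps
  cofactor {f} {s} {ps} prs coprime e
    with coprime-divides {s} {f} {∏ ps} coprime (∏⁺ ps , trans (sym e) (*-comm s (∏⁺ ps)))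
  ... | r , er = r , er , *-cancelˡ s (∣⇒≢0 (∏-≢0 prs) (r , er)) (begin
    s * (f * r)   ≡⟨ *-extractʳ s f r ⟩
    f * (r * s)   ≡⟨ cong (f *_) er ⟨
    f * ∏ ps      ≡⟨ e ⟨
    s * ∏⁺ ps     ∎)
    where open ≡-Reasoning

opaque
  -- Since y divides every 1 + p, it divides f² r. It cannot divide r, which divides a product of
  -- primes that are all 1 modulo y.
  ∣1+⇒∣f : ∀ {y f r s ps} → Prime y → All (λ p → y ∣ᶠ 1# + p) ps → 1 ≤ length ps →
    ∏ ps ≡ r * s → f * f * r ≡ ∏⁺ ps → y ∣ᶠ f
  ∣1+⇒∣f {y} {f} {r} {s} {ps} pr ∣1+ len er e
    with euclid {y} {f * f} {r} pr (subst (y ∣ᶠ_) (sym e) (∣∏⁺ ∣1+ len))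
  ... | inj₁ h = prime∣square pr h
  ... | inj₂ h = ⊥-elim (∤∏ pr (All.map (λ d d′ → ∤-1+ pr d′ d) ∣1+)
                   (subst (y ∣ᶠ_) (trans (*-comm s r) (sym er)) (∣-* s h)))

opaque
  linear-factors : ∀ f → f ≢ 0# → x ∣ᶠ f → x+1 ∣ᶠ f → ∃ λ a → ∃ λ b → ∃ λ h →
    f ≡ x ^ suc a * (x+1 ^ suc b * h) × h ≢ 0# ×
    sigma (f * f) ≡ geom x (suc a ℕ.+ suc a) * (geom x+1 (suc b ℕ.+ suc b) * sigma (h * h))
  linear-factors f f≢0 ∣₀ ∣₁ with valuation-pos (Complementary.prime-y x-complementary) f f≢0 ∣₀
  ... | a , g , refl , ∤₀ with euclid {x+1} {x ^ suc a} {g} (Complementary.prime-z x-complementary) ∣₁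
  ...   | inj₁ h = ⊥-elim (Complementary.y∤z^ (complementary-sym x-complementary) (suc a) h)
  ...   | inj₂ ∣g with valuation-pos (Complementary.prime-z x-complementary) g (∤⇒≢0 ∤₀) ∣g
  ...     | b , h , refl , ∤₁ = a , b , h , refl , ∤⇒≢0 ∤₁ ,
    trans (sigma-square (Complementary.prime-y x-complementary) (suc a) ∤₀)
      (cong (geom x (suc a ℕ.+ suc a) *_) (sigma-square (Complementary.prime-z x-complementary) (suc b) ∤₁))

perfect⇒listed : ∀ f ps → f ≢ 0# → All OddPrime ps → Unique ps → 1 ≤ length ps → length ps ≤ 3 →
  Coprime (sigma (f * f)) (f * f) → sigma (f * f) * ∏⁺ ps ≡ f * f * ∏ ps → Listed (f * f * ∏ ps)
perfect⇒listed f ps f≢0 odd unique len≥1 len≤3 coprime perfect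
  with cofactor {f * f} {sigma (f * f)} (All.map proj₁ odd) coprime perfect
... | r , er , eB
  with linear-factors f f≢0
         (∣1+⇒∣f (Complementary.prime-y x-complementary) (All.map (λ h → proj₁ (proj₂ h)) odd) len≥1 er eB)
         (∣1+⇒∣f (Complementary.prime-z x-complementary) (All.map (λ h → proj₂ (proj₂ h)) odd) len≥1 er eB)
... | a , b , h , refl , h≢0 , eσ with h ≟ 1#
... | yes refl = two-prime-factors a b odd unique len≤3 (begin
    U * (V * r)                    ≡⟨ solve 3 (λ U V r → U :* (V :* r) := r :* (U :* (V :* con true))) refl U V r ⟩
    r * (U * (V * 1#))             ≡⟨ cong (λ t → r * (U * (V * t))) (trans (cong sigma (*-identityˡ 1#)) sigma-1) ⟨
    r * (U * (V * sigma (1# * 1#)))  ≡⟨ cong (r *_) eσ ⟨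
    r * sigma (f * f)              ≡⟨ er ⟨
    ∏ ps                           ∎) eB
  where
  open ≡-Reasoning
  U V : 𝔽₂[x]
  U = geom x (suc a ℕ.+ suc a)
  V = geom x+1 (suc b ℕ.+ suc b)
-- `h` is what remains of B once the powers of x and x + 1 are removed; any prime factor of it
-- serves as Q.
... | no h≢1 with prime-factor h h≢0 h≢1
... | q , qr , q∣h with valuation-pos qr h h≢0 q∣h
... | c , k , refl , q∤k = ⊥-elim (three-prime-factors a b c {f = f} qr (All.map proj₁ odd) len≤3 (begin
    U * (V * (W * (sigma (k * k) * r)))
      ≡⟨ solve 5 (λ U V W s r → U :* (V :* (W :* (s :* r))) := r :* (U :* (V :* (W :* s)))) refl U V W (sigma (k * k)) r ⟩
    r * (U * (V * (W * sigma (k * k))))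
      ≡⟨ cong (λ t → r * (U * (V * t))) (sigma-square qr (suc c) q∤k) ⟨
    r * (U * (V * sigma (h * h)))
      ≡⟨ cong (r *_) eσ ⟨
    r * sigma (f * f)
      ≡⟨ er ⟨
    ∏ ps ∎) (sigma (k * k)) r refl eB)
  where
  open ≡-Reasoning
  U V W : 𝔽₂[x]
  U = geom x (suc a ℕ.+ suc a)
  V = geom x+1 (suc b ℕ.+ suc b)
  W = geom q (suc c ℕ.+ suc c)

∤-prime : ∀ {p q} → Prime p → Prime q → p ≢ q → ¬ p ∣ᶠ q
∤-prime {p} (_ , p≢1 , _) (_ , _ , irr) p≢q h with irr p h
... | inj₁ e = p≢1 e
... | inj₂ e = p≢q e

sigma-*∏ : ∀ f {ps} → All Prime ps → Unique ps → All (λ p → ¬ p ∣ᶠ f) ps → sigma (f * ∏ ps) ≡ sigma f * ∏⁺ ps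
sigma-*∏ f [] [] [] = trans (cong sigma (*-identityʳ f)) (sym (*-identityʳ (sigma f)))
sigma-*∏ f {p ∷ ps} (pr ∷ prs) (p∉ ∷ unique) (p∤f ∷ ∤f) = begin
  sigma (f * (p * ∏ ps))                  ≡⟨ cong sigma (solve 3 (λ f p t → f :* (p :* t) := p :^ 1 :* (f :* t)) refl f p (∏ ps)) ⟩
  sigma (p ^ 1 * (f * ∏ ps))              ≡⟨ sigma-prime-power pr 1 (∤-* pr p∤f p∤∏) ⟩
  geom p 1 * sigma (f * ∏ ps)             ≡⟨ cong (geom p 1 *_) (sigma-*∏ f prs unique ∤f) ⟩
  geom p 1 * (sigma f * ∏⁺ ps)            ≡⟨ solve 3 (λ p s t → (con true :+ p :* con true) :* (s :* t) := s :* ((con true :+ p) :* t)) refl p (sigma f) (∏⁺ ps) ⟩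
  sigma f * ((1# + p) * ∏⁺ ps)            ∎
  where
  open ≡-Reasoning
  p∤∏ : ¬ p ∣ᶠ ∏ ps
  p∤∏ = ∤∏ pr (All.zipWith (λ { (qr , p≢q) → ∤-prime pr qr p≢q }) (prs , p∉))

-- Translation from raw coefficient lists

∣ᶠ⇒∣ : ∀ {f} a → f ∣ᶠ [ a ] → poly f ∣ a
∣ᶠ⇒∣ {f} a (q , e) = poly q , []-injective (poly q *ₚ poly f) a
  (trans ([*ₚ] (poly q) (poly f)) (trans (cong₂ _*_ ([poly] q) ([poly] f)) (sym e)))

irreducible⇒prime : ∀ p → Irreducible p → Prime [ p ]
irreducible⇒prime p (p≉0 , p≉1 , irr) =
  (λ e → p≉0 ([]-injective p zeroP e)) , (λ e → p≉1 ([]-injective p oneP e)) , λ d h → go d (irr (poly d) (∣ᶠ⇒∣ p h))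
  where
  go : ∀ d → poly d ≈ oneP ⊎ poly d ≈ p → d ≡ 1# ⊎ d ≡ [ p ]
  go d (inj₁ e) = inj₁ (trans (sym ([poly] d)) ([]-cong (poly d) oneP e))
  go d (inj₂ e) = inj₂ (trans (sym ([poly] d)) ([]-cong (poly d) p e))

-- As x is 1 modulo x + 1, the remainder is the value at 1, accumulated coefficient by coefficient.
mod-x+1 : ∀ p → ∃ λ q → [ p ] ≡ const (eval1 p) + q * x+1
mod-x+1 [] = 0# , sym (trans (+-identityˡ _) (*-zeroˡ x+1))
mod-x+1 (b ∷ p) with mod-x+1 p
... | q , e = const (eval1 p) + x * q , (begin
  [ b ∷ p ]                                               ≡⟨ [∷] b p ⟩
  const b + x * [ p ]                                     ≡⟨ cong (λ t → const b + x * t) e ⟩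
  const b + x * (const (eval1 p) + q * x+1)               ≡⟨ cong (λ t → const b + x * (const (eval1 p) + q * t)) x+1≡ ⟩
  const b + x * (const (eval1 p) + q * (1# + x))
    ≡⟨ solve 4 (λ b x e q → b :+ x :* (e :+ q :* (con true :+ x)) := b :+ e :+ (e :+ x :* q) :* (con true :+ x)) refl (const b) x (const (eval1 p)) q ⟩
  const b + const (eval1 p) + (const (eval1 p) + x * q) * (1# + x)
    ≡⟨ cong₂ (λ s t → s + (const (eval1 p) + x * q) * t) (const-+ b (eval1 p)) x+1≡ ⟨
  const (b xor eval1 p) + (const (eval1 p) + x * q) * x+1 ∎)
  where
  open ≡-Reasoning
  x+1≡ : x+1 ≡ 1# + x
  x+1≡ = Complementary.z≡1+y x-complementary

1+[1+f] : ∀ f → 1# + (1# + f) ≡ f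
1+[1+f] = solve 1 (λ f → con true :+ (con true :+ f) := f) refl

odd⇒∣1+ : ∀ p → Odd p → x ∣ᶠ 1# + [ p ] × x+1 ∣ᶠ 1# + [ p ]
odd⇒∣1+ (true ∷ p) (refl , e₁) =
  ([ p ] , trans (cong (1# +_) ([∷] true p)) (trans (1+[1+f] (x * [ p ])) (*-comm x [ p ]))) ,
  (proj₁ (mod-x+1 (true ∷ p)) , trans (cong (1# +_) (trans (proj₂ (mod-x+1 (true ∷ p))) (cong (λ b → const b + proj₁ (mod-x+1 (true ∷ p)) * x+1) e₁)))
    (1+[1+f] _))

gcdOne⇒coprime : ∀ a b → GcdOne a b → Coprime [ b ] [ a ]
gcdOne⇒coprime a b gcd with bezout [ b ] [ a ]
... | d , u , v , d∣b , d∣a , e = u , v , trans (sym d≡1) e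
  where
  d≡1 : d ≡ 1#
  d≡1 = trans (sym ([poly] d)) ([]-cong (poly d) oneP (gcd (poly d) (∣ᶠ⇒∣ a d∣a) (∣ᶠ⇒∣ b d∣b)))

[prodFin] : ∀ r (P : Fin r → Poly) → [ prodFin r P ] ≡ ∏ (tabulate (λ i → [ P i ]))
[prodFin] zero P = refl
[prodFin] (suc r) P = trans ([*ₚ] (P Fin.zero) (prodFin r (λ i → P (Fin.suc i))))
  (cong ([ P Fin.zero ] *_) ([prodFin] r (λ i → P (Fin.suc i))))

theorem1 : (B : Poly) → Even B → GcdOne (B *ₚ B) (σ (B *ₚ B)) →
    (r : ℕ) → 1 ≤ r → r ≤ 3 → (P : Fin r → Poly) →
    (∀ i → Irreducible (P i)) → (∀ i → Odd (P i)) →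
    (∀ i j → P i ≈ P j → i ≡ j) → (∀ i → ¬ (P i ∣ B)) →
    Perfect ((B *ₚ B) *ₚ prodFin r P) →
    ((B *ₚ B) *ₚ prodFin r P ≈ M5a) ⊎ ((B *ₚ B) *ₚ prodFin r P ≈ M5b) ⊎
    ((B *ₚ B) *ₚ prodFin r P ≈ M16) ⊎ ((B *ₚ B) *ₚ prodFin r P ≈ M20a) ⊎
    ((B *ₚ B) *ₚ prodFin r P ≈ M20b)
theorem1 B _ gcd r@(suc _) 1≤r r≤3 P irr odd distinct ∤B perfect =
  conclude (perfect⇒listed f ps f≢0 (All.zip (primes , All.tabulate⁺ (λ i → odd⇒∣1+ (P i) (odd i)))) unique
    (subst (1 ≤_) (sym len) 1≤r) (subst (_≤ 3) (sym len) r≤3)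
    (subst₂ Coprime [σB²] [B²] (gcdOne⇒coprime (B *ₚ B) (σ (B *ₚ B)) gcd)) (begin
      sigma (f * f) * ∏⁺ ps   ≡⟨ sigma-*∏ (f * f) primes unique (All.tabulate⁺ λ i → ∤-* (irreducible⇒prime (P i) (irr i)) (∤f i) (∤f i)) ⟨
      sigma (f * f * ∏ ps)    ≡⟨ cong sigma [A] ⟨
      sigma [ A ]             ≡⟨ [σ] A (λ e → *-≢0 f²≢0 (∏-≢0 primes) (trans (sym [A]) e)) ⟨
      [ σ A ]                 ≡⟨ []-cong (σ A) A perfect ⟩
      [ A ]                   ≡⟨ [A] ⟩
      f * f * ∏ ps            ∎))
  where
  open ≡-Reasoning
  A : Poly
  A = (B *ₚ B) *ₚ prodFin r P
  f : 𝔽₂[x]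
  f = [ B ]
  ps : List 𝔽₂[x]
  ps = tabulate (λ i → [ P i ])
  len : length ps ≡ r
  len = List.length-tabulate (λ i → [ P i ])
  primes : All Prime ps
  primes = All.tabulate⁺ (λ i → irreducible⇒prime (P i) (irr i))
  unique : Unique ps
  unique = Unique.tabulate⁺ (λ {i} {j} e → distinct i j ([]-injective (P i) (P j) e))
  ∤f : ∀ i → ¬ [ P i ] ∣ᶠ f
  ∤f i (q , e) = ∤B i (poly q , []-injective (poly q *ₚ P i) B
    (trans ([*ₚ] (poly q) (P i)) (trans (cong (_* [ P i ]) ([poly] q)) (sym e))))
  f≢0 : f ≢ 0#
  -- Everything divides 0, so a single Pⱼ that does not divide B shows B to be nonzero; r ≥ 1
  -- supplies one.
  f≢0 = ∤⇒≢0 (∤f Fin.zero)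
  f²≢0 : f * f ≢ 0#
  f²≢0 = *-≢0 f≢0 f≢0
  [B²] : [ B *ₚ B ] ≡ f * f
  [B²] = [*ₚ] B B
  [σB²] : [ σ (B *ₚ B) ] ≡ sigma (f * f)
  [σB²] = trans ([σ] (B *ₚ B) (λ e → f²≢0 (trans (sym [B²]) e))) (cong sigma [B²])
  [A] : [ A ] ≡ f * f * ∏ ps
  [A] = trans ([*ₚ] (B *ₚ B) (prodFin r P)) (cong₂ _*_ [B²] ([prodFin] r P))
  conclude : Listed (f * f * ∏ ps) → (A ≈ M5a) ⊎ (A ≈ M5b) ⊎ (A ≈ M16) ⊎ (A ≈ M20a) ⊎ (A ≈ M20b)
  conclude (inj₁ e) = inj₂ (inj₂ (inj₁ ([]-injective A M16 (trans [A] e))))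
  conclude (inj₂ (inj₁ e)) = inj₂ (inj₂ (inj₂ (inj₁ ([]-injective A M20a (trans [A] e)))))
  conclude (inj₂ (inj₂ e)) = inj₂ (inj₂ (inj₂ (inj₂ ([]-injective A M20b (trans [A] e)))))
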